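{- Let $(\mathcal M_*,\mathcal M_{\le\omega})$ be a Büchi abstraction (with maps $\alpha_*,\gamma_*,\alpha_{\le\omega},\gamma_{\le\omega}$) that is faithful with respect to a language $\mathfrak A\subseteq\Sigma^{\le\omega}$, i.e. $\gamma_{\le\omega}(\alpha_{\le\omega}(\mathfrak A))=\mathfrak A$. Let $P$ be a Featherweight Java program that is well-typed with respect to some standard FJ class table $(F_0,M_0)$. Then the type inference algorithm $\mathcal A(P)$ described in the context yields a Büchi class table $(F,M_{\mathfrak A})$ with respect to which $P$ is well-typed.
   Context: WORDS. $\Sigma$ is a finite alphabet, $\Sigma^*$ the finite words ($\varepsilon$ the empty word), $\Sigma^{\le\omega}$ the finite and infinite words; $U\cdot V=\{uv\mid u\in U,v\in V\}$ for $U\subseteq\Sigma^*$ and $V\subseteq\Sigma^*$ or $V\subseteq\Sigma^{\le\omega}$; $U^\omega=\{u_1u_2\cdots\mid u_i\in U\}\subseteq\Sigma^{\le\omega}$. $\mathcal P$ is powerset. SYNTAX. Sets of names: variables $\mathit{Var}\ni\mathtt{this}$, classes $\mathit{Cls}\ni\mathtt{Object},\mathtt{NullType}$, fields $\mathit{Fld}$, methods $\mathit{Mtd}$, labels $\mathit{Pos}$ (a program has finitely many classes, fields, methods and labels). Expressions: $e::=x\mid\mathtt{let}\ x=e_1\ \mathtt{in}\ e_2\mid\mathtt{if}\ x=y\ \mathtt{then}\ e_1\ \mathtt{else}\ e_2\mid\mathtt{null}\mid\mathtt{new}^{\ell}\,C\mid(C)\,e\mid\mathtt{emit}(a)\mid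 x^C.m(\bar y)\mid x^C.f\mid x^C.f:=y$ with $a\in\Sigma$, $\ell\in\mathit{Pos}$; $\mathtt{NullType}$ may not occur in $\mathtt{new}$ or casts. The annotation $C$ in $x^C$ is the static class of $x$. PROGRAMS. A program $(\prec,\mathit{fields},\mathit{methods},\mathit{mtable})$ has a finite immediate-subclass relation $\prec$ on $\mathit{Cls}$, maps $\mathit{fields},\mathit{methods}$ from classes to finite sets of fields, resp. methods (including inherited ones), and a partial map $\mathit{mtable}$ from $\mathit{Cls}\times\mathit{Mtd}$ to pairs $(\bar x,e)$ (formal parameters and body). $\preceq$ is the reflexive transitive closure of $\prec$; $C\preceq\mathtt{Object}$ and $\mathtt{NullType}\preceq C$ for all $C$. Programs are well-formed: apart from $\mathtt{NullType}$ the classes form a tree with root $\mathtt{Object}$; for $C\preceq D$ with $C\neq\mathtt{NullType}$, $\mathit{fields}(D)\subseteq\mathit{fields}(C)$ and $\mathit{methods}(D)\subseteq\mathit{methods}(C)$; $\mathtt{NullType}$ has no fields or methods; $\mathit{mtable}(C,m)$ is defined iff $m\in\mathit{methods}(C)$, and methods keep their number of parameters $\mathrm{ar}(m)$ in subclasses. STANDARD FJ TYPING. A standard FJ class table consists of a field typing $F_0:\mathit{Cls}\times\mathit{Fld}\rightharpoonup\mathit{Cls}$ (invariant under subclassing) and a method typing $M_0:\mathit{Cls}\times\mathit{Mtd}\rightharpoonup\mathit{Cls}^*\times\mathit{Cls}$ (contravariant in arguments and covariant in results under subclassing). $P$ is well-typed w.r.t. it if every body $\mathit{mtable}(C,m)=(\bar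 x,e)$ with $M_0(C,m)=(\bar C,D)$ has class $D$ in the environment $\mathtt{this}{:}C,\bar x{:}\bar C$ in the usual Featherweight Java typing: variables are typed by the environment, $\mathtt{null}$ and $\mathtt{emit}(a)$ have class $\mathtt{NullType}$, $\mathtt{new}^\ell C$ and $(C)e$ have class $C$, $\mathtt{let}$ and $\mathtt{if}$ as usual, $x^C.f$, $x^C.f:=y$, $x^C.m(\bar y)$ require $x$ to have class $C$ (with $f\in\mathit{fields}(C)$, $m\in\mathit{methods}(C)$) and are typed by $F_0(C,f)$, $M_0(C,m)$, with subsumption along $\preceq$. REGIONS. $\mathit{Reg}\ni r::=\mathtt{Null}\mid\mathtt{CreatedAt}(\ell)\mid\mathtt{Unknown}$, $\ell\in\mathit{Pos}$. $\mathit{Cls}(\mathtt{Null})=\emptyset$, $\mathit{Cls}(\mathtt{CreatedAt}(\ell))=\{C\mid\text{the program contains }\mathtt{new}^\ell C\}$, $\mathit{Cls}(\mathtt{Unknown})=\mathit{Cls}$. $\mathtt{Null}$ and all $\mathtt{CreatedAt}(\ell)$ are pairwise disjoint; $\mathtt{Unknown}$ is disjoint from no region. BÜCHI ABSTRACTION. A Büchi algebra is a pair of join-semilattices $(\mathcal M_*,\mathcal M_{\le\omega})$ (order $\sqsubseteq$, join $\sqcup$) with monotone operations $\cdot:\mathcal M_*\times\mathcal M_*\to\mathcal M_*$, $\cdot:\mathcal M_*\times\mathcal M_{\le\omega}\to\mathcal M_{\le\omega}$, $(-)^\omega:\mathcal M_*\to\mathcal M_{\le\omega}$, with $\mathcal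 A\cdot(\mathcal B\cdot\mathcal U)=(\mathcal A\cdot\mathcal B)\cdot\mathcal U$ for $\mathcal A,\mathcal B\in\mathcal M_*$, $\mathcal U\in\mathcal M_*\cup\mathcal M_{\le\omega}$. A Galois insertion between partial orders $A$ and $C$ consists of monotone $\alpha:C\to A$, $\gamma:A\to C$ with $\alpha(\gamma(a))=a$ and $\gamma(\alpha(c))\sqsupseteq c$. A Büchi abstraction is a finite Büchi algebra with Galois insertions $(\alpha_*,\gamma_*)$ between $\mathcal M_*$ and $\mathcal P(\Sigma^*)$ and $(\alpha_{\le\omega},\gamma_{\le\omega})$ between $\mathcal M_{\le\omega}$ and $\mathcal P(\Sigma^{\le\omega})$ such that $\alpha_*(A\cdot B)=\alpha_*(A)\cdot\alpha_*(B)$, $\alpha_{\le\omega}(A\cdot V)=\alpha_*(A)\cdot\alpha_{\le\omega}(V)$, $\alpha_{\le\omega}(A^\omega)=\alpha_*(A)^\omega$ for all $A,B\subseteq\Sigma^*$, $V\subseteq\Sigma^{\le\omega}$. Its least elements are $\alpha_*(\emptyset)$ and $\alpha_{\le\omega}(\emptyset)$. EXPRESSIONS AND BÜCHI CLASS TABLES. For a set $K$, $\mathcal M_*\langle K\rangle$ is the set of finite partial functions from $K$ to $\mathcal M_*$; undefined entries are treated as the least element, $\emptyset$ is the empty function, and order, join and left multiplication $\mathcal U\cdot(-)$ are pointwise. $r_1\mathrel{\&}\mathcal U_1\mid\dots\mid r_n\mathrel{\&}\mathcal U_n$ denotes the element of $\mathcal M_*\langle\mathit{Reg}\rangle$ mapping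 $r_i\mapsto\mathcal U_i$. A method signature is a tuple $(C,r,m,\bar s)$ with $m\in\mathit{methods}(C)$, $r\in\mathit{Reg}$, $\bar s\in\mathit{Reg}^{\mathrm{ar}(m)}$; $\mathit{Sig}$ is the set of these. Elements $\bigsqcup_i\mathcal A_i\cdot\delta_i$ of $\mathcal M_*\langle\mathit{Sig}\rangle$ are call expressions; $\delta$ alone denotes $\alpha_*(\{\varepsilon\})\cdot\delta$. A Büchi class table $(F,M_{\mathfrak A})$ consists of $F:\mathit{Cls}\times\mathit{Reg}\times\mathit{Fld}\rightharpoonup\mathcal P(\mathit{Reg})$ (defined for $f\in\mathit{fields}(C)$) and $M_{\mathfrak A}:\mathit{Sig}\to\mathcal M_*\langle\mathit{Reg}\rangle\times\mathcal M_*\langle\mathit{Sig}\rangle$, well-formed (wherever the entries are defined): $\mathtt{Null}\in F(C,r,f)\subseteq F(C,\mathtt{Unknown},f)$; $F(C,r,f)=F(D,r,f)$ if $C\preceq D$, $f\in\mathit{fields}(D)$; $M_{\mathfrak A}(C,r,m,\bar s)\sqsubseteq M_{\mathfrak A}(D,r,m,\bar s)$ componentwise if $C\preceq D$, $m\in\mathit{methods}(D)$. BÜCHI TYPING RULES. $\Gamma:\mathit{Var}\rightharpoonup\mathit{Reg}$; judgments $\Gamma\vdash_{\mathfrak A}e:\mathcal T\ \mathsf{calls}\ \mathcal S$ are derived by (writing $\epsilon=\alpha_*(\{\varepsilon\})$): - (sub) from $\Gamma\vdash_{\mathfrak A}e:\mathcal T\ \mathsf{calls}\ \mathcal S$, $\mathcal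 T\sqsubseteq\mathcal T'$, $\mathcal S\sqsubseteq\mathcal S'$ infer $\Gamma\vdash_{\mathfrak A}e:\mathcal T'\ \mathsf{calls}\ \mathcal S'$. - (weak) from $\Gamma\vdash_{\mathfrak A}e:(r\mathrel{\&}\mathcal U)\sqcup\mathcal T\ \mathsf{calls}\ \mathcal S$ infer $\Gamma\vdash_{\mathfrak A}e:(\mathtt{Unknown}\mathrel{\&}\mathcal U)\sqcup\mathcal T\ \mathsf{calls}\ \mathcal S$. - (prim) $\Gamma\vdash_{\mathfrak A}\mathtt{emit}(a):\mathtt{Null}\mathrel{\&}\alpha_*(\{a\})\ \mathsf{calls}\ \emptyset$. (null) $\Gamma\vdash_{\mathfrak A}\mathtt{null}:\mathtt{Null}\mathrel{\&}\epsilon\ \mathsf{calls}\ \emptyset$. (new) $\Gamma\vdash_{\mathfrak A}\mathtt{new}^\ell C:\mathtt{CreatedAt}(\ell)\mathrel{\&}\epsilon\ \mathsf{calls}\ \emptyset$. (var) $\Gamma\vdash_{\mathfrak A}x:\Gamma(x)\mathrel{\&}\epsilon\ \mathsf{calls}\ \emptyset$. - (if) from $\Gamma\vdash_{\mathfrak A}e_i:\mathcal T_i\ \mathsf{calls}\ \mathcal S_i$ ($i=1,2$), $x,y\in\mathrm{dom}(\Gamma)$, infer $\Gamma\vdash_{\mathfrak A}\mathtt{if}\ x=y\ \mathtt{then}\ e_1\ \mathtt{else}\ e_2:\mathcal T_1\sqcup\mathcal T_2\ \mathsf{calls}\ \mathcal S_1\sqcup\mathcal S_2$. - (else) if $\Gamma(x),\Gamma(y)$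 are disjoint, from $\Gamma\vdash_{\mathfrak A}e_2:\mathcal T_2\ \mathsf{calls}\ \mathcal S_2$ infer $\Gamma\vdash_{\mathfrak A}\mathtt{if}\ x=y\ \mathtt{then}\ e_1\ \mathtt{else}\ e_2:\mathcal T_2\ \mathsf{calls}\ \mathcal S_2$. - (let) from $\Gamma\vdash_{\mathfrak A}e_1:r_1\mathrel{\&}\mathcal U_1\mid\dots\mid r_n\mathrel{\&}\mathcal U_n\ \mathsf{calls}\ \mathcal S$ and $\Gamma,x{:}r_i\vdash_{\mathfrak A}e_2:\mathcal T_i\ \mathsf{calls}\ \mathcal S_i$ for all $i$ infer $\Gamma\vdash_{\mathfrak A}\mathtt{let}\ x=e_1\ \mathtt{in}\ e_2:\bigsqcup_i\mathcal U_i\cdot\mathcal T_i\ \mathsf{calls}\ \mathcal S\sqcup\bigsqcup_i\mathcal U_i\cdot\mathcal S_i$. - (cast) from $\Gamma\vdash_{\mathfrak A}e:\mathcal T\ \mathsf{calls}\ \mathcal S$ infer $\Gamma\vdash_{\mathfrak A}(D)e:\mathcal T\ \mathsf{calls}\ \mathcal S$. - (get) $\Gamma\vdash_{\mathfrak A}x^C.f:\bigsqcup\{s\mathrel{\&}\epsilon\mid s\in F(C,\Gamma(x),f)\}\ \mathsf{calls}\ \emptyset$. - (set) if $\Gamma(y)\in F(C,\Gamma(x),f)$, then $\Gamma\vdash_{\mathfrak A}x^C.f:=y:\Gamma(y)\mathrel{\&}\epsilon\ \mathsf{calls}\ \emptyset$. - (call) if $r=\Gamma(x)$, $\bar s=\Gamma(\bar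 y)$, $(\mathcal T,\_)=M_{\mathfrak A}(C,r,m,\bar s)$, then $\Gamma\vdash_{\mathfrak A}x^C.m(\bar y):\mathcal T\ \mathsf{calls}\ (C,r,m,\bar s)$. $P$ is well-typed w.r.t. $(F,M_{\mathfrak A})$ if for each $(C,r,m,\bar s)\in\mathit{Sig}$ with $C\in\mathit{Cls}(r)$, $M_{\mathfrak A}(C,r,m,\bar s)=(\mathcal T,\mathcal S)$, $\mathit{mtable}(C,m)=(\bar x,e)$, the judgment $\mathtt{this}{:}r,\bar x{:}\bar s\vdash_{\mathfrak A}e:\mathcal T\ \mathsf{calls}\ \mathcal S$ is derivable. ALGORITHM $\mathcal A(P)$. Initialize $F(C,r,f):=\{\mathtt{Null}\}$ for all $C\in\mathit{Cls}$, $r\in\mathit{Reg}$, $f\in\mathit{fields}(C)$, and $M_{\mathfrak A}(C,r,m,\bar s):=(\emptyset,\emptyset)$ for all $(C,r,m,\bar s)\in\mathit{Sig}$. Repeat the following round until a full round leaves $(F,M_{\mathfrak A})$ unchanged, then return $(F,M_{\mathfrak A})$: for each $(C,r,m,\bar s)\in\mathit{Sig}$ with $C\in\mathit{Cls}(r)$ and $(C,m)\in\mathrm{dom}(\mathit{mtable})$, let $(\bar x,e)=\mathit{mtable}(C,m)$, $\Gamma=[\mathtt{this}\mapsto r]\cup[x_i\mapsto s_i]_i$, compute $(\mathcal T,\mathcal S):=\mathrm{typeff}(\Gamma,e)$, set $M_{\mathfrak A}(C,r,m,\bar s):=M_{\mathfrak A}(C,r,m,\bar s)\sqcup(\mathcal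 T,\mathcal S)$ (componentwise), and set $(F,M_{\mathfrak A}):=\mathrm{checkClassTable}(F,M_{\mathfrak A})$, which enlarges the entries, by joining offending ones, to the least well-formed table above $(F,M_{\mathfrak A})$ (e.g. if $C\preceq D$ and $F(C,r,f)\neq F(D,r,f)$, both are set to $F(C,r,f)\cup F(D,r,f)$). $\mathrm{typeff}(\Gamma,e)$, which reads the current $(F,M_{\mathfrak A})$ and may enlarge $F$, returns: - $\mathtt{emit}(a)$: $(\mathtt{Null}\mathrel{\&}\alpha_*(\{a\}),\emptyset)$; $x$: $(\Gamma(x)\mathrel{\&}\epsilon,\emptyset)$; $\mathtt{null}$: $(\mathtt{Null}\mathrel{\&}\epsilon,\emptyset)$; $\mathtt{new}^\ell C$: $(\mathtt{CreatedAt}(\ell)\mathrel{\&}\epsilon,\emptyset)$; $(D)e$: $\mathrm{typeff}(\Gamma,e)$. - $\mathtt{if}\ x=y\ \mathtt{then}\ e_1\ \mathtt{else}\ e_2$: $\mathrm{typeff}(\Gamma,e_2)$ if $\Gamma(x),\Gamma(y)$ are disjoint, else $\mathrm{typeff}(\Gamma,e_1)\sqcup\mathrm{typeff}(\Gamma,e_2)$. - $\mathtt{let}\ x=e_1\ \mathtt{in}\ e_2$: with $(r_1\mathrel{\&}\mathcal U_1\mid\dots\mid r_n\mathrel{\&}\mathcal U_n,\mathcal S)=\mathrm{typeff}(\Gamma,e_1)$ and $(\mathcal T_i,\mathcal S_i)=\mathrm{typeff}(\Gamma[x\mapsto r_i],e_2)$, returns $(\bigsqcup_i\mathcal U_i\cdot\mathcal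 T_i,\ \mathcal S\sqcup\bigsqcup_i\mathcal U_i\cdot\mathcal S_i)$. - $x^C.f$: $(\bigsqcup\{s\mathrel{\&}\epsilon\mid s\in F(C,\Gamma(x),f)\},\emptyset)$. - $x^C.f:=y$: first $F(C,\Gamma(x),f):=F(C,\Gamma(x),f)\cup\{\Gamma(y)\}$, then returns $(\Gamma(y)\mathrel{\&}\epsilon,\emptyset)$. - $x^C.m(\bar y)$: with $(\mathcal T,\_)=M_{\mathfrak A}(C,\Gamma(x),m,\Gamma(\bar y))$, returns $(\mathcal T,(C,\Gamma(x),m,\Gamma(\bar y)))$. -}

module Defs where

open import Level using (Level; 0ℓ; _⊔_) renaming (suc to lsuc)
open import Data.Bool.Base using (Bool; true; false; T; _∧_; _∨_; if_then_else_)
open import Data.Bool.ListAction using (any)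
open import Data.Empty using (⊥)
open import Data.Fin.Base using (Fin; toℕ)
import Data.Fin.Properties as Fin
open import Data.Fin.Subset using (Subset; _∈_; _∉_; _⊆_)
open import Data.Fin.Subset.Properties using (_∈?_)
open import Data.List.Base using (List; []; _∷_; _++_; allFin; foldr; length; lookup; map)
open import Data.List.Membership.Propositional using () renaming (_∈_ to _∈ˡ_)
open import Data.List.Properties using (++-assoc)
open import Data.List.Relation.Unary.Any using (here; there)
open import Data.List.Relation.Unary.Unique.Propositional using (Unique)
open import Data.List.Membership.Propositional.Properties using (∈-allFin)
open import Data.Maybe.Base as Maybe using (Maybe; just; nothing; maybe′; _>>=_)
open import Data.Maybe using (Is-just)
open import Data.Nat.Base using (ℕ; zero; suc; _≤_; _<_)
open import Data.Product.Base using (∃-syntax; _×_; _,_; proj₁; proj₂)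
open import Data.Sum.Base using (_⊎_; inj₁; inj₂)
open import Data.Unit.Base using (⊤; tt)
open import Data.Vec.Base as Vec using (Vec; []; _∷_)
import Data.Vec.Properties as Vec
open import Data.Vec.Relation.Binary.Pointwise.Inductive using (Pointwise)
open import Function.Bundles using (_⇔_; _↔_)
open import Relation.Binary.Bundles using (Poset)
open import Relation.Binary.Core using (Rel; _Preserves_⟶_; _Preserves₂_⟶_⟶_)
open import Relation.Binary.Construct.Closure.ReflexiveTransitive using (Star; ε; _◅_; _◅◅_)
open import Relation.Binary.Definitions using (Decidable; DecidableEquality; _Respects_)
open import Relation.Binary.Lattice.Structures using (IsJoinSemilattice)
open import Relation.Binary.PropositionalEquality
  using (_≡_; _≢_; _≗_; refl; sym; trans; cong)
open import Relation.Nullary using (¬_; Dec; yes; no; ¬?; _×-dec_; _⊎-dec_)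
open import Relation.Nullary.Decidable using (⌊_⌋; map′)
open import Relation.Unary using (Pred; _≐_; ∅; ｛_｝) renaming (_⊆_ to _⊆ᴾ_; _∈_ to _∈ᴾ_)
open import Relation.Unary.Relation.Binary.Subset using (⊆-poset)

Lang* : Set → Set₁
Lang* A = Pred (List A) 0ℓ

data Word≤ω (A : Set) : Set where
  fin : List A → Word≤ω A
  inf : (ℕ → A) → Word≤ω A

data _≈ʷ_ {A : Set} : Rel (Word≤ω A) 0ℓ where
  fin : ∀ {u v} → u ≡ v → fin u ≈ʷ fin v
  inf : ∀ {s t} → s ≗ t → inf s ≈ʷ inf t

_++ˢ_ : {A : Set} → List A → (ℕ → A) → (ℕ → A)
([]      ++ˢ s) n       = s n
((a ∷ u) ++ˢ s) zero    = a
((a ∷ u) ++ˢ s) (suc n) = (u ++ˢ s) n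

_++ʷ_ : {A : Set} → List A → Word≤ω A → Word≤ω A
u ++ʷ fin v = fin (u ++ v)
u ++ʷ inf s = inf (u ++ˢ s)

-- Infinite words are functions, so a subset of Σ^{≤ω} is a predicate that
-- does not distinguish pointwise equal infinite words.
record Lang≤ω (A : Set) : Set₁ where
  field
    member : Pred (Word≤ω A) 0ℓ
    resp   : member Respects _≈ʷ_

open Lang≤ω public

⊆≤ω-poset : Set → Poset _ _ _
⊆≤ω-poset A = record
  { Carrier        = Lang≤ω A
  ; _≈_            = λ V W → member V ≐ member W
  ; _≤_            = λ V W → member V ⊆ᴾ member W
  ; isPartialOrder = record
    { isPreorder = record
      { isEquivalence = record
        { refl  = (λ x → x) , (λ x → x)
        ; sym   = λ (p , q) → q , p
        ; trans = λ (p , q) (p′ , q′) → (λ x → p′ (p x)) , (λ x → q (q′ x))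
        }
      ; reflexive = proj₁
      ; trans     = λ p q x → q (p x)
      }
    ; antisym = _,_
    }
  }

≈ʷ-trans : {A : Set} {u v w : Word≤ω A} → u ≈ʷ v → v ≈ʷ w → u ≈ʷ w
≈ʷ-trans (fin p) (fin q) = fin (trans p q)
≈ʷ-trans (inf p) (inf q) = inf (λ n → trans (p n) (q n))

≈ʷ-sym : {A : Set} {u v : Word≤ω A} → u ≈ʷ v → v ≈ʷ u
≈ʷ-sym (fin p) = fin (sym p)
≈ʷ-sym (inf p) = inf (λ n → sym (p n))

∅≤ω : {A : Set} → Lang≤ω A
∅≤ω .member _ = ⊥
∅≤ω .resp _ ()

_·ᴸ_ : {A : Set} → Lang* A → Lang* A → Lang* A
(U ·ᴸ V) w = ∃[ u ] ∃[ v ] u ∈ᴾ U × v ∈ᴾ V × w ≡ u ++ v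

_·ᴸω_ : {A : Set} → Lang* A → Lang≤ω A → Lang≤ω A
(U ·ᴸω V) .member w = ∃[ u ] ∃[ v ] u ∈ᴾ U × v ∈ᴾ member V × w ≈ʷ (u ++ʷ v)
(U ·ᴸω V) .resp w≈w′ (u , v , u∈ , v∈ , eq) = u , v , u∈ , v∈ , ≈ʷ-trans (≈ʷ-sym w≈w′) eq

concatUpTo : {A : Set} → (ℕ → List A) → ℕ → List A
concatUpTo u zero    = []
concatUpTo u (suc n) = concatUpTo u n ++ u n

-- w is the concatenation u₀u₁u₂⋯: finite if the finite concatenations
-- eventually stop growing, and otherwise the infinite word that has all of
-- them as prefixes.
IsConcat : {A : Set} → (ℕ → List A) → Word≤ω A → Set
IsConcat u (fin v) = ∃[ N ] ∀ n → N ≤ n → concatUpTo u n ≡ v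
IsConcat u (inf s) =
    (∀ n (i : Fin (length (concatUpTo u n))) → lookup (concatUpTo u n) i ≡ s (toℕ i))
  × (∀ k → ∃[ n ] k < length (concatUpTo u n))

_^ω : {A : Set} → Lang* A → Lang≤ω A
(U ^ω) .member w = ∃[ u ] (∀ i → u i ∈ᴾ U) × IsConcat u w
(U ^ω) .resp (fin refl) h = h
(U ^ω) .resp (inf s≗t) (u , u∈ , pre , unb) =
  u , u∈ , (λ n i → trans (pre n i) (s≗t (toℕ i))) , unb

IsFinite : Set → Set
IsFinite A = ∃[ n ] (A ↔ Fin n)


record Enumeration (X : Set) : Set where
  field
    list     : List X
    unique   : Unique list
    complete : ∀ x → x ∈ˡ list

record GaloisInsertion {a₁ a₂ a₃ c₁ c₂ c₃ : Level}
       (A : Poset a₁ a₂ a₃) (C : Poset c₁ c₂ c₃)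
       : Set (a₁ ⊔ a₂ ⊔ a₃ ⊔ c₁ ⊔ c₂ ⊔ c₃) where
  private
    module A = Poset A
    module C = Poset C
  field
    α      : C.Carrier → A.Carrier
    γ      : A.Carrier → C.Carrier
    α-mono : α Preserves C._≤_ ⟶ A._≤_
    γ-mono : γ Preserves A._≤_ ⟶ C._≤_
    α∘γ    : ∀ a → α (γ a) A.≈ a
    γ∘α    : ∀ c → c C.≤ γ (α c)

record BüchiAlgebra : Set₁ where
  infixr 7 _·_ _·ω_
  infixr 6 _⊔*_ _⊔ω_
  infix 4 _⊑*_ _⊑ω_
  field
    M*   : Set
    _⊑*_ : Rel M* 0ℓ
    _⊔*_ : M* → M* → M*
    isJoinSemilattice* : IsJoinSemilattice _≡_ _⊑*_ _⊔*_

    Mω   : Set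
    _⊑ω_ : Rel Mω 0ℓ
    _⊔ω_ : Mω → Mω → Mω
    isJoinSemilatticeω : IsJoinSemilattice _≡_ _⊑ω_ _⊔ω_

    _·_  : M* → M* → M*
    _·ω_ : M* → Mω → Mω
    _^ω′ : M* → Mω

    ·-mono  : _·_ Preserves₂ _⊑*_ ⟶ _⊑*_ ⟶ _⊑*_
    ·ω-mono : _·ω_ Preserves₂ _⊑*_ ⟶ _⊑ω_ ⟶ _⊑ω_
    ^ω-mono : _^ω′ Preserves _⊑*_ ⟶ _⊑ω_

    ·-assoc  : ∀ a b c → a · (b · c) ≡ (a · b) · c
    ·ω-assoc : ∀ a b u → a ·ω (b ·ω u) ≡ (a · b) ·ω u

  poset* : Poset 0ℓ 0ℓ 0ℓ
  poset* = record { isPartialOrder = IsJoinSemilattice.isPartialOrder isJoinSemilattice* }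

  posetω : Poset 0ℓ 0ℓ 0ℓ
  posetω = record { isPartialOrder = IsJoinSemilattice.isPartialOrder isJoinSemilatticeω }

record BüchiAbstraction (A : Set) : Set₁ where
  field
    algebra : BüchiAlgebra

  open BüchiAlgebra algebra public

  field
    finite* : IsFinite M*
    finiteω : IsFinite Mω

    insertion* : GaloisInsertion poset* (⊆-poset (List A) 0ℓ)
    insertionω : GaloisInsertion posetω (⊆≤ω-poset A)

  open GaloisInsertion insertion* public using ()
    renaming (α to α*; γ to γ*)
  open GaloisInsertion insertionω public using ()
    renaming (α to αω; γ to γω)

  field
    α*-·  : ∀ (U V : Lang* A) → α* (U ·ᴸ V) ≡ α* U · α* V
    αω-·  : ∀ (U : Lang* A) (V : Lang≤ω A) → αω (U ·ᴸω V) ≡ α* U ·ω αω V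
    αω-^ω : ∀ (U : Lang* A) → αω (U ^ω) ≡ (α* U) ^ω′

  bot* : M*
  bot* = α* ∅

  unit* : M*
  unit* = α* ｛ [] ｝

  letter* : A → M*
  letter* a = α* ｛ a ∷ [] ｝

FaithfulTo : {A : Set} → BüchiAbstraction A → Lang≤ω A → Set
FaithfulTo 𝔹 𝔄 = member (γω (αω 𝔄)) ≐ member 𝔄
  where open BüchiAbstraction 𝔹

-- Warshall: Reach ps i j says that j is reachable from i through intermediate
-- points in ps.

module Reachability {n : ℕ} {R : Rel (Fin n) 0ℓ} (R? : Decidable R) where

  Reach : List (Fin n) → Rel (Fin n) 0ℓ
  Reach []       i j = i ≡ j ⊎ R i j
  Reach (p ∷ ps) i j = Reach ps i j ⊎ (Reach ps i p × Reach ps p j)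

  reach? : ∀ ps → Decidable (Reach ps)
  reach? []       i j = (i Fin.≟ j) ⊎-dec R? i j
  reach? (p ∷ ps) i j = reach? ps i j ⊎-dec (reach? ps i p ×-dec reach? ps p j)

  sound : ∀ ps {i j} → Reach ps i j → Star R i j
  sound []       (inj₁ refl)    = ε
  sound []       (inj₂ r)       = r ◅ ε
  sound (p ∷ ps) (inj₁ x)       = sound ps x
  sound (p ∷ ps) (inj₂ (x , y)) = sound ps x ◅◅ sound ps y

  base : ∀ ps {i j} → i ≡ j ⊎ R i j → Reach ps i j
  base []       x = x
  base (p ∷ ps) x = inj₁ (base ps x)

  to-pivot : ∀ p ps {i} → Reach (p ∷ ps) i p → Reach ps i p
  to-pivot p ps (inj₁ x)       = x
  to-pivot p ps (inj₂ (x , _)) = x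

  from-pivot : ∀ p ps {j} → Reach (p ∷ ps) p j → Reach ps p j
  from-pivot p ps (inj₁ x)       = x
  from-pivot p ps (inj₂ (_ , y)) = y

  compose : ∀ ps {i k j} → k ∈ˡ ps → Reach ps i k → Reach ps k j → Reach ps i j
  compose (p ∷ ps) (here refl) x y = inj₂ (to-pivot p ps x , from-pivot p ps y)
  compose (p ∷ ps) (there k∈) (inj₁ x)        (inj₁ y)        = inj₁ (compose ps k∈ x y)
  compose (p ∷ ps) (there k∈) (inj₁ x)        (inj₂ (y , y′)) = inj₂ (compose ps k∈ x y , y′)
  compose (p ∷ ps) (there k∈) (inj₂ (x , x′)) (inj₁ y)        = inj₂ (x , compose ps k∈ x′ y)
  compose (p ∷ ps) (there k∈) (inj₂ (x , x′)) (inj₂ (y , y′)) = inj₂ (x , y′)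

  complete : ∀ {i j} → Star R i j → Reach (allFin n) i j
  complete ε        = base (allFin n) (inj₁ refl)
  complete (r ◅ rs) = compose (allFin n) (∈-allFin _) (base (allFin n) (inj₂ r)) (complete rs)

  star? : Decidable (Star R)
  star? i j = map′ (sound (allFin n)) complete (reach? (allFin n) i j)

record Names : Set₁ where
  field
    Var  : Set
    _≟ⱽ_ : DecidableEquality Var
    this : Var
    #Cls #Fld #Mtd #Pos : ℕ
    Object NullType : Fin #Cls
    ar : Fin #Mtd → ℕ

  Cls Fld Mtd Pos : Set
  Cls = Fin #Cls
  Fld = Fin #Fld
  Mtd = Fin #Mtd
  Pos = Fin #Pos

module Syntax (A : Set) (N : Names) where
  open Names N public

  data Expr : Set where
    var      : Var → Expr
    let′     : (x : Var) (e₁ e₂ : Expr) → Expr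
    ifEq     : (x y : Var) (e₁ e₂ : Expr) → Expr
    null     : Expr
    new      : (ℓ : Pos) (C : Cls) → C ≢ NullType → Expr
    cast     : (C : Cls) → C ≢ NullType → Expr → Expr
    emit     : A → Expr
    call     : (x : Var) (C : Cls) (m : Mtd) → Vec Var (ar m) → Expr
    get      : (x : Var) (C : Cls) (f : Fld) → Expr
    set      : (x : Var) (C : Cls) (f : Fld) (y : Var) → Expr

  ContainsNew : Pos → Cls → Expr → Set
  ContainsNew ℓ C (let′ _ e₁ e₂)   = ContainsNew ℓ C e₁ ⊎ ContainsNew ℓ C e₂
  ContainsNew ℓ C (ifEq _ _ e₁ e₂) = ContainsNew ℓ C e₁ ⊎ ContainsNew ℓ C e₂
  ContainsNew ℓ C (new ℓ′ C′ _)    = ℓ ≡ ℓ′ × C ≡ C′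
  ContainsNew ℓ C (cast _ _ e)     = ContainsNew ℓ C e
  ContainsNew ℓ C (var _)          = ⊥
  ContainsNew ℓ C null             = ⊥
  ContainsNew ℓ C (emit _)         = ⊥
  ContainsNew ℓ C (call _ _ _ _)   = ⊥
  ContainsNew ℓ C (get _ _ _)      = ⊥
  ContainsNew ℓ C (set _ _ _ _)    = ⊥

  containsNew? : ∀ ℓ C e → Dec (ContainsNew ℓ C e)
  containsNew? ℓ C (let′ _ e₁ e₂)   = containsNew? ℓ C e₁ ⊎-dec containsNew? ℓ C e₂
  containsNew? ℓ C (ifEq _ _ e₁ e₂) = containsNew? ℓ C e₁ ⊎-dec containsNew? ℓ C e₂
  containsNew? ℓ C (new ℓ′ C′ _)    = (ℓ Fin.≟ ℓ′) ×-dec (C Fin.≟ C′)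
  containsNew? ℓ C (cast _ _ e)     = containsNew? ℓ C e
  containsNew? ℓ C (var _)          = no λ ()
  containsNew? ℓ C null             = no λ ()
  containsNew? ℓ C (emit _)         = no λ ()
  containsNew? ℓ C (call _ _ _ _)   = no λ ()
  containsNew? ℓ C (get _ _ _)      = no λ ()
  containsNew? ℓ C (set _ _ _ _)    = no λ ()

  data Region : Set where
    Null      : Region
    CreatedAt : Pos → Region
    Unknown   : Region

  _≟ᴿ_ : DecidableEquality Region
  Null        ≟ᴿ Null         = yes refl
  Null        ≟ᴿ CreatedAt _  = no λ ()
  Null        ≟ᴿ Unknown      = no λ ()
  CreatedAt _ ≟ᴿ Null         = no λ ()
  CreatedAt ℓ ≟ᴿ CreatedAt ℓ′ = map′ (cong CreatedAt) (λ { refl → refl }) (ℓ Fin.≟ ℓ′)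
  CreatedAt _ ≟ᴿ Unknown      = no λ ()
  Unknown     ≟ᴿ Null         = no λ ()
  Unknown     ≟ᴿ CreatedAt _  = no λ ()
  Unknown     ≟ᴿ Unknown      = yes refl

  allRegions : List Region
  allRegions = Null ∷ Unknown ∷ map CreatedAt (allFin #Pos)

  -- Null and each CreatedAt ℓ overlap with themselves and with Unknown only.
  Disjoint : Rel Region 0ℓ
  Disjoint r s = r ≢ Unknown × s ≢ Unknown × r ≢ s

  disjoint? : Decidable Disjoint
  disjoint? r s = ¬? (r ≟ᴿ Unknown) ×-dec ¬? (s ≟ᴿ Unknown) ×-dec ¬? (r ≟ᴿ s)

  Env : Set → Set
  Env X = Var → Maybe X

  _[_↦_] : {X : Set} → Env X → Var → X → Env X
  (Γ [ x ↦ v ]) y = if ⌊ x ≟ⱽ y ⌋ then just v else Γ y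

  _[_↦*_] : {X : Set} {n : ℕ} → Env X → Vec Var n → Vec X n → Env X
  Γ [ []     ↦* []     ] = Γ
  Γ [ x ∷ xs ↦* v ∷ vs ] = (Γ [ x ↦ v ]) [ xs ↦* vs ]

  -- Later bindings shadow earlier ones; for distinct parameters other than this
  -- it is the union of the bindings.
  bodyEnv : {X : Set} {n : ℕ} → X → Vec Var n → Vec X n → Env X
  bodyEnv c xs vs = ((λ _ → nothing) [ this ↦ c ]) [ xs ↦* vs ]

  lookup* : {X : Set} {n : ℕ} → Env X → Vec Var n → Maybe (Vec X n)
  lookup* Γ []       = just []
  lookup* Γ (y ∷ ys) = do
    v  ← Γ y
    vs ← lookup* Γ ys
    just (v ∷ vs)

record Program (A : Set) (N : Names) : Set₁ where
  open Syntax A N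
  infix 4 _≺_ _⪯_
  field
    _≺_     : Rel Cls 0ℓ
    _≺?_    : Decidable _≺_
    fields  : Cls → Subset #Fld
    methods : Cls → Subset #Mtd
    mtable  : Cls → (m : Mtd) → Maybe (Vec Var (ar m) × Expr)

  _⪯_ : Rel Cls 0ℓ
  _⪯_ = Star _≺_

  _⪯?_ : Decidable _⪯_
  _⪯?_ = Reachability.star? _≺?_

record WellFormedProgram {A : Set} {N : Names} (P : Program A N) : Set where
  open Syntax A N
  open Program P
  field
    ⪯Object   : ∀ C → C ⪯ Object
    NullType⪯ : ∀ C → NullType ⪯ C

    -- Together with ⪯Object, these say that the classes other than NullType
    -- form a tree with root Object, strictly above NullType.
    Object≢NullType   : Object ≢ NullType
    Object-root       : ∀ D → ¬ (Object ≺ D)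
    superclass-unique : ∀ {C D D′} → C ≢ NullType → C ≺ D → C ≺ D′ → D ≡ D′
    NullType-minimal  : ∀ C → ¬ (C ≺ NullType)

    fields-inherited  : ∀ {C D} → C ⪯ D → C ≢ NullType → fields D ⊆ fields C
    methods-inherited : ∀ {C D} → C ⪯ D → C ≢ NullType → methods D ⊆ methods C
    NullType-fields   : ∀ f → f ∉ fields NullType
    NullType-methods  : ∀ m → m ∉ methods NullType
    mtable-domain     : ∀ C m → Is-just (mtable C m) ⇔ m ∈ methods C

module Standard {A : Set} {N : Names} (P : Program A N) where
  open Syntax A N
  open Program P

  record ClassTable₀ : Set where
    field
      F₀ : (C : Cls) (f : Fld) → .(f ∈ fields C) → Cls
      M₀ : (C : Cls) (m : Mtd) → .(m ∈ methods C) → Vec Cls (ar m) × Cls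

      F₀-invariant : ∀ {C D f} (f∈C : f ∈ fields C) (f∈D : f ∈ fields D) →
                     C ⪯ D → F₀ C f f∈C ≡ F₀ D f f∈D
      M₀-variant   : ∀ {C D m} (m∈C : m ∈ methods C) (m∈D : m ∈ methods D) → C ⪯ D →
                     Pointwise _⪯_ (proj₁ (M₀ D m m∈D)) (proj₁ (M₀ C m m∈C)) ×
                     proj₂ (M₀ C m m∈C) ⪯ proj₂ (M₀ D m m∈D)

  module _ (T₀ : ClassTable₀) where
    open ClassTable₀ T₀

    infix 4 _⊢₀_∶_
    data _⊢₀_∶_ (Γ : Env Cls) : Expr → Cls → Set where
      sub₀  : ∀ {e C D} → Γ ⊢₀ e ∶ C → C ⪯ D → Γ ⊢₀ e ∶ D
      var₀  : ∀ {x C} → Γ x ≡ just C → Γ ⊢₀ var x ∶ C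
      null₀ : Γ ⊢₀ null ∶ NullType
      emit₀ : ∀ {a} → Γ ⊢₀ emit a ∶ NullType
      new₀  : ∀ {ℓ C} (C≢ : C ≢ NullType) → Γ ⊢₀ new ℓ C C≢ ∶ C
      cast₀ : ∀ {C D e} (C≢ : C ≢ NullType) → Γ ⊢₀ e ∶ D → Γ ⊢₀ cast C C≢ e ∶ C
      let₀  : ∀ {x e₁ e₂ C D} → Γ ⊢₀ e₁ ∶ C → (Γ [ x ↦ C ]) ⊢₀ e₂ ∶ D →
              Γ ⊢₀ let′ x e₁ e₂ ∶ D
      if₀   : ∀ {x y e₁ e₂ D} → Is-just (Γ x) → Is-just (Γ y) →
              Γ ⊢₀ e₁ ∶ D → Γ ⊢₀ e₂ ∶ D → Γ ⊢₀ ifEq x y e₁ e₂ ∶ D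
      get₀  : ∀ {x C f} → Γ ⊢₀ var x ∶ C → (f∈ : f ∈ fields C) →
              Γ ⊢₀ get x C f ∶ F₀ C f f∈
      set₀  : ∀ {x y C f} → Γ ⊢₀ var x ∶ C → (f∈ : f ∈ fields C) →
              Γ ⊢₀ var y ∶ F₀ C f f∈ → Γ ⊢₀ set x C f y ∶ F₀ C f f∈
      call₀ : ∀ {x C m ys} → Γ ⊢₀ var x ∶ C → (m∈ : m ∈ methods C) →
              Pointwise (λ y D → Γ ⊢₀ var y ∶ D) ys (proj₁ (M₀ C m m∈)) →
              Γ ⊢₀ call x C m ys ∶ proj₂ (M₀ C m m∈)

    WellTyped₀ : Set
    WellTyped₀ = ∀ C m (m∈ : m ∈ methods C) {xs e} → mtable C m ≡ just (xs , e) →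
                 bodyEnv C xs (proj₁ (M₀ C m m∈)) ⊢₀ e ∶ proj₂ (M₀ C m m∈)

module Büchi {A : Set} (𝔹 : BüchiAbstraction A) {N : Names} (P : Program A N) where
  open BüchiAbstraction 𝔹
  open Syntax A N
  open Program P

  _∈Cls_ : Cls → Region → Set
  C ∈Cls Null        = ⊥
  C ∈Cls CreatedAt ℓ =
    ∃[ D ] ∃[ m ] maybe′ (λ (_ , e) → ContainsNew ℓ C e) ⊥ (mtable D m)
  C ∈Cls Unknown     = ⊤

  _∈Cls?_ : ∀ C r → Dec (C ∈Cls r)
  C ∈Cls? Null        = no λ ()
  C ∈Cls? CreatedAt ℓ = Fin.any? λ D → Fin.any? λ m → inBody (mtable D m)
    where
    inBody : ∀ {X : Set} (b : Maybe (X × Expr)) →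
             Dec (maybe′ (λ (_ , e) → ContainsNew ℓ C e) ⊥ b)
    inBody nothing        = no λ ()
    inBody (just (_ , e)) = containsNew? ℓ C e
  C ∈Cls? Unknown     = yes tt

  record Sig : Set where
    constructor sig
    field
      cls  : Cls
      reg  : Region
      mtd  : Mtd
      args : Vec Region (ar mtd)
      .mtd∈ : mtd ∈ methods cls

  _≟ˢ_ : DecidableEquality Sig
  sig C r m s _ ≟ˢ sig C′ r′ m′ s′ _ with C Fin.≟ C′ | r ≟ᴿ r′ | m Fin.≟ m′
  ... | no ¬p    | _        | _        = no λ { refl → ¬p refl }
  ... | yes _    | no ¬p    | _        = no λ { refl → ¬p refl }
  ... | yes _    | yes _    | no ¬p    = no λ { refl → ¬p refl }
  ... | yes refl | yes refl | yes refl =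
    map′ (λ { refl → refl }) (λ { refl → refl }) (Vec.≡-dec _≟ᴿ_ s s′)

  -- Finite partial functions to M*: the index sets used below (Region, Sig)
  -- are finite, so finiteness of the domain is automatic.
  M*⟨_⟩ : Set → Set
  M*⟨ K ⟩ = K → Maybe M*

  infix  4 _⊑_ _⊑ᴱ_
  infixr 6 _⊔ᴹ_ _⊔ᵖ_ _⊔ᴱ_
  infixr 7 _⊙_ _⊙ᴱ_

  -- Undefined entries count as the least element.
  _⊑_ : ∀ {K} → Rel (M*⟨ K ⟩) 0ℓ
  𝒯 ⊑ 𝒯′ = ∀ k → Maybe.fromMaybe bot* (𝒯 k) ⊑* Maybe.fromMaybe bot* (𝒯′ k)

  _⊔ᴹ_ : Maybe M* → Maybe M* → Maybe M*
  just U  ⊔ᴹ just V  = just (U ⊔* V)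
  just U  ⊔ᴹ nothing = just U
  nothing ⊔ᴹ V       = V

  _⊔ᵖ_ : ∀ {K} → M*⟨ K ⟩ → M*⟨ K ⟩ → M*⟨ K ⟩
  (𝒯 ⊔ᵖ 𝒯′) k = 𝒯 k ⊔ᴹ 𝒯′ k

  _⊙_ : ∀ {K} → M* → M*⟨ K ⟩ → M*⟨ K ⟩
  (U ⊙ 𝒯) k = Maybe.map (U ·_) (𝒯 k)

  ∅ᵖ : ∀ {K} → M*⟨ K ⟩
  ∅ᵖ _ = nothing

  infix 8 _&_
  _&_ : Region → M* → M*⟨ Region ⟩
  (r & U) s = if ⌊ r ≟ᴿ s ⌋ then just U else nothing

  callTo : Sig → M*⟨ Sig ⟩
  callTo δ δ′ = if ⌊ δ ≟ˢ δ′ ⌋ then just unit* else nothing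

  Effect : Set
  Effect = M*⟨ Region ⟩ × M*⟨ Sig ⟩

  _⊑ᴱ_ : Rel Effect 0ℓ
  (𝒯 , 𝒮) ⊑ᴱ (𝒯′ , 𝒮′) = 𝒯 ⊑ 𝒯′ × 𝒮 ⊑ 𝒮′

  _⊔ᴱ_ : Effect → Effect → Effect
  (𝒯 , 𝒮) ⊔ᴱ (𝒯′ , 𝒮′) = (𝒯 ⊔ᵖ 𝒯′) , (𝒮 ⊔ᵖ 𝒮′)

  _⊙ᴱ_ : M* → Effect → Effect
  U ⊙ᴱ (𝒯 , 𝒮) = (U ⊙ 𝒯) , (U ⊙ 𝒮)

  ∅ᴱ : Effect
  ∅ᴱ = ∅ᵖ , ∅ᵖ

  𝒫Region : Set
  𝒫Region = Region → Bool

  infix 4 _∈ᴿ_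
  _∈ᴿ_ : Region → 𝒫Region → Set
  s ∈ᴿ X = T (X s)

  ⨆& : 𝒫Region → M*⟨ Region ⟩
  ⨆& X s = if X s then just unit* else nothing

  FTable : Set
  FTable = (C : Cls) → Region → (f : Fld) → .(f ∈ fields C) → 𝒫Region

  MTable : Set
  MTable = Sig → Effect

  Table : Set
  Table = FTable × MTable

  record WellFormedTable (t : Table) : Set where
    private
      F = proj₁ t
      M = proj₂ t
    field
      Null∈     : ∀ C r f (f∈ : f ∈ fields C) → Null ∈ᴿ F C r f f∈
      ⊆Unknown  : ∀ C r f (f∈ : f ∈ fields C) s →
                  s ∈ᴿ F C r f f∈ → s ∈ᴿ F C Unknown f f∈
      invariant : ∀ {C D} r f (f∈C : f ∈ fields C) (f∈D : f ∈ fields D) →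
                  C ⪯ D → F C r f f∈C ≗ F D r f f∈D
      variant   : ∀ {C D} r m s (m∈C : m ∈ methods C) (m∈D : m ∈ methods D) →
                  C ⪯ D → M (sig C r m s m∈C) ⊑ᴱ M (sig D r m s m∈D)

  -- The join of U · E r over all entries r & U of 𝒯, for r in the given list.
  ⨆let : List Region → M*⟨ Region ⟩ → (Region → Effect) → Effect
  ⨆let rs 𝒯 E = foldr (λ r acc → maybe′ (λ U → (U ⊙ᴱ E r) ⊔ᴱ acc) acc (𝒯 r)) ∅ᴱ rs

  module Typing (t : Table) where
    private
      F = proj₁ t
      M = proj₂ t

    infix 4 _⊢_∶_calls_
    data _⊢_∶_calls_ (Γ : Env Region) : Expr → M*⟨ Region ⟩ → M*⟨ Sig ⟩ → Set where
      sub   : ∀ {e 𝒯 𝒯′ 𝒮 𝒮′} → Γ ⊢ e ∶ 𝒯 calls 𝒮 → 𝒯 ⊑ 𝒯′ → 𝒮 ⊑ 𝒮′ →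
              Γ ⊢ e ∶ 𝒯′ calls 𝒮′
      weak  : ∀ {e r U 𝒯 𝒮} → Γ ⊢ e ∶ (r & U) ⊔ᵖ 𝒯 calls 𝒮 →
              Γ ⊢ e ∶ (Unknown & U) ⊔ᵖ 𝒯 calls 𝒮
      prim  : ∀ {a} → Γ ⊢ emit a ∶ Null & letter* a calls ∅ᵖ
      null  : Γ ⊢ null ∶ Null & unit* calls ∅ᵖ
      new   : ∀ {ℓ C} (C≢ : C ≢ NullType) →
              Γ ⊢ new ℓ C C≢ ∶ CreatedAt ℓ & unit* calls ∅ᵖ
      var   : ∀ {x r} → Γ x ≡ just r → Γ ⊢ var x ∶ r & unit* calls ∅ᵖ
      if    : ∀ {x y e₁ e₂ 𝒯₁ 𝒯₂ 𝒮₁ 𝒮₂} → Is-just (Γ x) → Is-just (Γ y) →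
              Γ ⊢ e₁ ∶ 𝒯₁ calls 𝒮₁ → Γ ⊢ e₂ ∶ 𝒯₂ calls 𝒮₂ →
              Γ ⊢ ifEq x y e₁ e₂ ∶ 𝒯₁ ⊔ᵖ 𝒯₂ calls (𝒮₁ ⊔ᵖ 𝒮₂)
      else  : ∀ {x y r s e₁ e₂ 𝒯₂ 𝒮₂} → Γ x ≡ just r → Γ y ≡ just s → Disjoint r s →
              Γ ⊢ e₂ ∶ 𝒯₂ calls 𝒮₂ → Γ ⊢ ifEq x y e₁ e₂ ∶ 𝒯₂ calls 𝒮₂
      let′  : ∀ {x e₁ e₂ 𝒯 𝒮} (E : Region → Effect) →
              Γ ⊢ e₁ ∶ 𝒯 calls 𝒮 →
              (∀ r U → 𝒯 r ≡ just U →
                 (Γ [ x ↦ r ]) ⊢ e₂ ∶ proj₁ (E r) calls proj₂ (E r)) →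
              Γ ⊢ let′ x e₁ e₂ ∶ proj₁ (⨆let allRegions 𝒯 E)
                calls (𝒮 ⊔ᵖ proj₂ (⨆let allRegions 𝒯 E))
      cast  : ∀ {D e 𝒯 𝒮} (D≢ : D ≢ NullType) → Γ ⊢ e ∶ 𝒯 calls 𝒮 →
              Γ ⊢ cast D D≢ e ∶ 𝒯 calls 𝒮
      get   : ∀ {x C f r} → Γ x ≡ just r → (f∈ : f ∈ fields C) →
              Γ ⊢ get x C f ∶ ⨆& (F C r f f∈) calls ∅ᵖ
      set   : ∀ {x y C f r s} → Γ x ≡ just r → Γ y ≡ just s → (f∈ : f ∈ fields C) →
              s ∈ᴿ F C r f f∈ → Γ ⊢ set x C f y ∶ s & unit* calls ∅ᵖ
      call  : ∀ {x C m ys r s} → Γ x ≡ just r → lookup* Γ ys ≡ just s →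
              (m∈ : m ∈ methods C) →
              Γ ⊢ call x C m ys ∶ proj₁ (M (sig C r m s m∈)) calls callTo (sig C r m s m∈)

  WellTyped : Table → Set
  WellTyped t = ∀ C r m s (m∈ : m ∈ methods C) {xs e} → C ∈Cls r →
                mtable C m ≡ just (xs , e) →
                bodyEnv r xs s ⊢ e ∶ proj₁ (proj₂ t (sig C r m s m∈))
                  calls proj₂ (proj₂ t (sig C r m s m∈))
    where open Typing t

  -- checkClassTable yields the least well-formed table above its argument: field
  -- entries are shared along the equivalence closure of ⪯ on the classes that have the
  -- field, and method entries are joined upwards along ⪯.

  Related : Fld → Rel Cls 0ℓ
  Related f C D = f ∈ fields C × f ∈ fields D × (C ⪯ D ⊎ D ⪯ C)

  related? : ∀ f → Decidable (Related f)
  related? f C D = (f ∈? fields C) ×-dec (f ∈? fields D) ×-dec ((C ⪯? D) ⊎-dec (D ⪯? C))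

  sameField? : ∀ f → Decidable (Star (Related f))
  sameField? f = Reachability.star? (related? f)

  entry : FTable → Cls → Region → Fld → 𝒫Region
  entry F D r f s with f ∈? fields D
  ... | yes f∈ = F D r f f∈ s
  ... | no _   = false

  checkF : FTable → FTable
  checkF F C r f _ s = ⌊ s ≟ᴿ Null ⌋ ∨
    any (λ D → ⌊ sameField? f C D ⌋ ∧
          any (λ r′ → (⌊ r ≟ᴿ Unknown ⌋ ∨ ⌊ r ≟ᴿ r′ ⌋) ∧ entry F D r′ f s) allRegions)
        (allFin #Cls)

  checkM : MTable → MTable
  checkM M (sig D r m s _) = foldr (λ C acc → contribution C ⊔ᴱ acc) ∅ᴱ (allFin #Cls)
    where
    contribution : Cls → Effect
    contribution C with C ⪯? D | m ∈? methods C
    ... | yes _ | yes m∈ = M (sig C r m s m∈)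
    ... | _     | _      = ∅ᴱ

  checkClassTable : Table → Table
  checkClassTable (F , M) = checkF F , checkM M

  -- Failing lookups (unbound variables, missing members) make
  -- the algorithm undefined, represented by nothing.
  -- The list rs fixes the order in which let visits the regions.

  addF : Cls → Region → Fld → Region → FTable → FTable
  addF C r f s F C′ r′ f′ f′∈ s′ =
    F C′ r′ f′ f′∈ s′ ∨ ⌊ C Fin.≟ C′ ⌋ ∧ ⌊ r ≟ᴿ r′ ⌋ ∧ ⌊ f Fin.≟ f′ ⌋ ∧ ⌊ s ≟ᴿ s′ ⌋

  guard : {X : Set} → Dec X → Maybe X
  guard (yes x) = just x
  guard (no _)  = nothing

  module Inference (rs : List Region) where

    letBranches : (Region → FTable → Maybe (FTable × Effect)) → M*⟨ Region ⟩ →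
                  List Region → FTable → Maybe (FTable × Effect)
    letBranches body 𝒯 []       F = just (F , ∅ᴱ)
    letBranches body 𝒯 (r ∷ rs) F with 𝒯 r
    ... | nothing = letBranches body 𝒯 rs F
    ... | just U  = do
      (F₁ , E₁) ← body r F
      (F₂ , E₂) ← letBranches body 𝒯 rs F₁
      just (F₂ , (U ⊙ᴱ E₁) ⊔ᴱ E₂)

    typeff : MTable → Env Region → Expr → FTable → Maybe (FTable × Effect)
    typeff M Γ (var x) F = do
      r ← Γ x
      just (F , r & unit* , ∅ᵖ)
    typeff M Γ (let′ x e₁ e₂) F = do
      (F₁ , 𝒯₁ , 𝒮₁) ← typeff M Γ e₁ F
      (F₂ , 𝒯₂ , 𝒮₂) ← letBranches (λ r → typeff M (Γ [ x ↦ r ]) e₂) 𝒯₁ rs F₁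
      just (F₂ , 𝒯₂ , 𝒮₁ ⊔ᵖ 𝒮₂)
    typeff M Γ (ifEq x y e₁ e₂) F = do
      r ← Γ x
      s ← Γ y
      if ⌊ disjoint? r s ⌋
        then typeff M Γ e₂ F
        else (do
          (F₁ , E₁) ← typeff M Γ e₁ F
          (F₂ , E₂) ← typeff M Γ e₂ F₁
          just (F₂ , E₁ ⊔ᴱ E₂))
    typeff M Γ null        F = just (F , Null & unit* , ∅ᵖ)
    typeff M Γ (new ℓ C _) F = just (F , CreatedAt ℓ & unit* , ∅ᵖ)
    typeff M Γ (cast _ _ e) F = typeff M Γ e F
    typeff M Γ (emit a)    F = just (F , Null & letter* a , ∅ᵖ)
    typeff M Γ (call x C m ys) F = do
      r  ← Γ x
      s  ← lookup* Γ ys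
      m∈ ← guard (m ∈? methods C)
      just (F , proj₁ (M (sig C r m s m∈)) , callTo (sig C r m s m∈))
    typeff M Γ (get x C f) F = do
      r  ← Γ x
      f∈ ← guard (f ∈? fields C)
      just (F , ⨆& (F C r f f∈) , ∅ᵖ)
    typeff M Γ (set x C f y) F = do
      r  ← Γ x
      s  ← Γ y
      f∈ ← guard (f ∈? fields C)
      just (addF C r f s F , s & unit* , ∅ᵖ)

    joinM : Sig → Effect → MTable → MTable
    joinM σ E M σ′ = if ⌊ σ ≟ˢ σ′ ⌋ then M σ′ ⊔ᴱ E else M σ′

    visit : Sig → Table → Maybe Table
    visit σ@(sig C r m s _) t@(F , M) with C ∈Cls? r | mtable C m
    ... | yes _ | just (xs , e) = do
      (F′ , E) ← typeff M (bodyEnv r xs s) e F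
      just (checkClassTable (F′ , joinM σ E M))
    ... | _     | _             = just t

    round : List Sig → Table → Maybe Table
    round []       t = just t
    round (σ ∷ σs) t = visit σ t >>= round σs

  -- Literal equality as partial functions: an undefined entry differs from an
  -- entry with value bot*.
  _≗ᵗ_ : Rel Table 0ℓ
  (F , M) ≗ᵗ (F′ , M′) =
      (∀ C r f (f∈ : f ∈ fields C) → F C r f f∈ ≗ F′ C r f f∈)
    × (∀ σ → proj₁ (M σ) ≗ proj₁ (M′ σ) × proj₂ (M σ) ≗ proj₂ (M′ σ))

  initial : Table
  initial = (λ _ _ _ _ s → ⌊ s ≟ᴿ Null ⌋) , (λ _ → ∅ᴱ)

  -- The loop of 𝒜, started at the first table, terminates and returns the
  -- second one.  The two enumerations fix the orders in which a round visits
  -- Sig and in which let visits the regions.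
  module Loop (sigs : Enumeration Sig) (regs : Enumeration Region) where
    open Inference (Enumeration.list regs)

    oneRound : Table → Maybe Table
    oneRound = round (Enumeration.list sigs)

    data Returns : Rel Table 0ℓ where
      stop  : ∀ {t t′} → oneRound t ≡ just t′ → t ≗ᵗ t′ → Returns t t′
      again : ∀ {t t′ t″} → oneRound t ≡ just t′ → ¬ (t ≗ᵗ t′) →
              Returns t′ t″ → Returns t t″

  𝒜-returns : Enumeration Sig → Enumeration Region → Table → Set
  𝒜-returns sigs regs = Loop.Returns sigs regs initial

{-# OPTIONS --safe #-}

module Submission where

-- The algorithm is a fixed-point iteration, and the theorem combines four facts about
-- it.  Tables are compared by the order _≼ᵗ_ in which an undefined entry lies strictly
-- below every defined one; it refines the order _⊑_, and it is antisymmetric up to the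
-- literal equality of tables that the loop tests.
--
-- (1) Definedness.  typeff fails only at an unbound variable or a missing member.  The
-- standard typing excludes both, so every visit and every round is defined.
--
-- (2) Growth.  typeff only enlarges F, and the join into M and checkClassTable only
-- enlarge the table.  Hence every round yields a table above the one it starts from.
--
-- (3) Termination.  A table is determined by the set of elementary facts that hold in it
-- (a region lies in a field entry, or an element of M* lies below an effect entry), and
-- there are finitely many of these.  A round that changes the table makes a new fact true
-- and keeps the others, so the number of false facts decreases (unchanged-or-closer).
--
-- (4) Soundness at a fixed point.  If typeff turns (F , M) into (F′ , M) and returns E,
-- then E is derivable with respect to every table u that lies below (F , M) and whose
-- field part lies above F′.  The lower bound gives what the rules for field reads and
-- calls need, since what typeff read in the current table lies above the corresponding
-- entry of u; the upper bound gives the membership that field writes need.  This is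
-- proved together with (1) and (2) by induction on the standard typing derivation
-- (infer).  When a round leaves the table unchanged, all tables that occur during that
-- round are squeezed between its equal ends, so the final table satisfies both bounds
-- for every body that was visited.
--
-- The final table is well-formed because the initial one is and because every visit
-- either leaves the table as it is or ends with checkClassTable.

open import Defs
open import Data.Bool.Base using (Bool; true; false; T; _∧_; _∨_)
open import Data.Bool.Properties using (T-∧; T-∨; T?)
open import Data.Bool.ListAction using (any)
open import Data.Empty using (⊥-elim)
open import Data.Fin.Base using (Fin)
import Data.Fin.Properties as Fin
open import Data.Fin.Subset using (_∈_)
open import Data.Fin.Subset.Properties using (_∈?_)
open import Data.List.Base
  using (List; []; _∷_; _++_; allFin; cartesianProduct; filter; foldr; length; map)
open import Data.List.Membership.Propositional using (find; lose) renaming (_∈_ to _∈ˡ_)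
open import Data.List.Membership.Propositional.Properties
  using (∈-allFin; ∈-cartesianProduct⁺; ∈-map⁺; ∈-++⁺ˡ; ∈-++⁺ʳ)
open import Data.List.Relation.Unary.Any using (here; there) renaming (any? to anyList?)
open import Data.List.Relation.Unary.Any.Properties using (any⁺; any⁻)
open import Data.Maybe.Base using (Maybe; just; nothing; fromMaybe; _>>=_)
open import Data.Maybe using (Is-just)
open import Data.Maybe.Relation.Unary.Any using (just)
open import Data.Nat.Base using (ℕ; _<_; _≤_; s≤s; z≤n)
open import Data.Nat.Induction using (<-wellFounded)
import Data.Nat.Properties as ℕ
open import Data.Product.Base using (∃-syntax; Σ-syntax; _×_; _,_; proj₁; proj₂)
open import Data.Sum.Base using (_⊎_; inj₁; inj₂)
open import Data.Unit.Base using (tt)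
open import Data.Vec.Base using (Vec; []; _∷_)
open import Data.Vec.Relation.Binary.Pointwise.Inductive using (Pointwise; []; _∷_)
open import Function.Base using (_∘_; id)
open import Function.Bundles using (Equivalence; Inverse)
open import Function.Properties.Inverse using (↔⇒↣)
open import Induction.WellFounded using (Acc; acc)
open import Relation.Binary.Construct.Add.Infimum.NonStrict
  using (≤₋-antisym-≡; ≤₋-dec; ≤₋-reflexive-≡; ≤₋-trans)
open import Relation.Binary.Construct.Closure.ReflexiveTransitive using (Star; ε; _◅_; _◅◅_)
open import Relation.Binary.Lattice.Structures using (IsJoinSemilattice)
open import Relation.Binary.PropositionalEquality using (_≡_; refl; sym; trans; subst)
open import Relation.Nullary using (¬_; Dec; yes; no; ¬?; _×-dec_; contradiction)
open import Relation.Nullary.Decidable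
  using (⌊_⌋; map′; decidable-stable; recompute; toWitness; fromWitness)
open import Relation.Unary using () renaming (Decidable to Decidable₁)

-- Finite types and counting

-- A list of all elements, possibly with repetitions.
Listing : Set → Set
Listing X = Σ[ xs ∈ List X ] ∀ x → x ∈ˡ xs

_×-listing_ : {X Y : Set} → Listing X → Listing Y → Listing (X × Y)
(xs , ∈xs) ×-listing (ys , ∈ys) =
  cartesianProduct xs ys , λ (x , y) → ∈-cartesianProduct⁺ (∈xs x) (∈ys y)

_⊎-listing_ : {X Y : Set} → Listing X → Listing Y → Listing (X ⊎ Y)
(xs , ∈xs) ⊎-listing (ys , ∈ys) = map inj₁ xs ++ map inj₂ ys , λ where
  (inj₁ x) → ∈-++⁺ˡ (∈-map⁺ inj₁ (∈xs x))
  (inj₂ y) → ∈-++⁺ʳ (map inj₁ xs) (∈-map⁺ inj₂ (∈ys y))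

module _ {X : Set} {P Q : X → Set} (P? : Decidable₁ P) (Q? : Decidable₁ Q)
         (P⇒Q : ∀ {x} → P x → Q x) where

  length-filter-mono : ∀ xs → length (filter P? xs) ≤ length (filter Q? xs)
  length-filter-mono []       = z≤n
  length-filter-mono (x ∷ xs) with P? x | Q? x
  ... | yes p | yes _ = s≤s (length-filter-mono xs)
  ... | yes p | no ¬q = contradiction (P⇒Q p) ¬q
  ... | no  _ | yes _ = ℕ.m≤n⇒m≤1+n (length-filter-mono xs)
  ... | no  _ | no  _ = length-filter-mono xs

  length-filter-strict : ∀ {x xs} → x ∈ˡ xs → Q x → ¬ P x →
                         length (filter P? xs) < length (filter Q? xs)
  length-filter-strict {x} {_ ∷ xs} (here refl) q ¬p with P? x | Q? x
  ... | yes p | _     = contradiction p ¬p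
  ... | no  _ | no ¬q = contradiction q ¬q
  ... | no  _ | yes _ = s≤s (length-filter-mono xs)
  length-filter-strict {_} {y ∷ _} (there x∈) q ¬p with P? y | Q? y
  ... | yes p | yes _ = s≤s (length-filter-strict x∈ q ¬p)
  ... | yes p | no ¬q = contradiction (P⇒Q p) ¬q
  ... | no  _ | yes _ = ℕ.m≤n⇒m≤1+n (length-filter-strict x∈ q ¬p)
  ... | no  _ | no  _ = length-filter-strict x∈ q ¬p

-- Booleans and partial values

T-ext : ∀ {a b} → (T a → T b) → (T b → T a) → a ≡ b
T-ext {true}  {true}  _ _ = refl
T-ext {false} {false} _ _ = refl
T-ext {true}  {false} f _ = ⊥-elim (f tt)
T-ext {false} {true}  _ g = ⊥-elim (g tt)

Is-just⇒≡just : {X : Set} {m : Maybe X} → Is-just m → ∃[ x ] m ≡ just x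
Is-just⇒≡just {m = just x} _ = x , refl

≡just⇒Is-just : {X : Set} {m : Maybe X} {x : X} → m ≡ just x → Is-just m
≡just⇒Is-just refl = just tt

module Correctness {A : Set} (𝔹 : BüchiAbstraction A) {N : Names} (P : Program A N) where
  open BüchiAbstraction 𝔹
  open Syntax A N
  open Program P
  open Büchi 𝔹 P
  open Equivalence using (to; from)
  open IsJoinSemilattice isJoinSemilattice*
    using (x≤x∨y; y≤x∨y; ∨-least; antisym)
    renaming (refl to ⊑*-refl; reflexive to ⊑*-reflexive; trans to ⊑*-trans)
  open Relation.Binary.Construct.Add.Infimum.NonStrict _⊑*_
    using () renaming (_≤₋_ to _≼_; ⊥₋≤_ to nothing≼_; [_] to just≼)

  infix 4 _≼ᴱ_ _≼ᶠ_ _≼ᵗ_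

  -- The order on tables

  -- On entries, _≼_ is the order of M* with a new least element for undefined entries.
  -- It is finer than the order _⊑_, for which an undefined entry equals bot*.

  ≼-refl : ∀ {x} → x ≼ x
  ≼-refl = ≤₋-reflexive-≡ _⊑*_ ⊑*-reflexive refl

  ≼-reflexive : ∀ {x y} → x ≡ y → x ≼ y
  ≼-reflexive refl = ≼-refl

  ≼-trans : ∀ {x y z} → x ≼ y → y ≼ z → x ≼ z
  ≼-trans = ≤₋-trans _⊑*_ ⊑*-trans

  ≼-antisym : ∀ {x y} → x ≼ y → y ≼ x → x ≡ y
  ≼-antisym = ≤₋-antisym-≡ _⊑*_ antisym

  ⊔ᴹ-upperˡ : ∀ x y → x ≼ x ⊔ᴹ y
  ⊔ᴹ-upperˡ nothing  y        = nothing≼ y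
  ⊔ᴹ-upperˡ (just U) nothing  = ≼-refl
  ⊔ᴹ-upperˡ (just U) (just V) = just≼ (x≤x∨y U V)

  ⊔ᴹ-upperʳ : ∀ x y → y ≼ x ⊔ᴹ y
  ⊔ᴹ-upperʳ nothing  y        = ≼-refl
  ⊔ᴹ-upperʳ (just U) nothing  = nothing≼ _
  ⊔ᴹ-upperʳ (just U) (just V) = just≼ (y≤x∨y U V)

  ⊔ᴹ-least : ∀ {x y z} → x ≼ z → y ≼ z → x ⊔ᴹ y ≼ z
  ⊔ᴹ-least (nothing≼ _) q            = q
  ⊔ᴹ-least (just≼ p)    (nothing≼ _) = just≼ p
  ⊔ᴹ-least (just≼ p)    (just≼ q)    = just≼ (∨-least p q)

  bot*-least : ∀ U → bot* ⊑* U
  bot*-least U = subst (bot* ⊑*_) (α∘γ U) (α-mono λ ())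
    where open GaloisInsertion insertion*

  ≼⇒⊑* : ∀ {x y} → x ≼ y → fromMaybe bot* x ⊑* fromMaybe bot* y
  ≼⇒⊑* (nothing≼ _) = bot*-least _
  ≼⇒⊑* (just≼ p)    = p

  -- The pointwise order on effects.
  _≼ᴱ_ : Effect → Effect → Set
  (𝒯 , 𝒮) ≼ᴱ (𝒯′ , 𝒮′) = (∀ r → 𝒯 r ≼ 𝒯′ r) × (∀ σ → 𝒮 σ ≼ 𝒮′ σ)

  ≼ᴱ-refl : ∀ {E} → E ≼ᴱ E
  ≼ᴱ-refl = (λ _ → ≼-refl) , (λ _ → ≼-refl)

  ≼ᴱ-trans : ∀ {E E′ E″} → E ≼ᴱ E′ → E′ ≼ᴱ E″ → E ≼ᴱ E″
  ≼ᴱ-trans (p , q) (p′ , q′) = (λ r → ≼-trans (p r) (p′ r)) , (λ σ → ≼-trans (q σ) (q′ σ))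

  ∅ᴱ-least : ∀ {E} → ∅ᴱ ≼ᴱ E
  ∅ᴱ-least = (λ _ → nothing≼ _) , (λ _ → nothing≼ _)

  ⊔ᴱ-upperˡ : ∀ E E′ → E ≼ᴱ E ⊔ᴱ E′
  ⊔ᴱ-upperˡ _ _ = (λ _ → ⊔ᴹ-upperˡ _ _) , (λ _ → ⊔ᴹ-upperˡ _ _)

  ⊔ᴱ-upperʳ : ∀ E E′ → E′ ≼ᴱ E ⊔ᴱ E′
  ⊔ᴱ-upperʳ E _ = (λ r → ⊔ᴹ-upperʳ (proj₁ E r) _) , (λ σ → ⊔ᴹ-upperʳ (proj₂ E σ) _)

  ⊔ᴱ-least : ∀ {E E′ E″} → E ≼ᴱ E″ → E′ ≼ᴱ E″ → E ⊔ᴱ E′ ≼ᴱ E″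
  ⊔ᴱ-least (p , q) (p′ , q′) = (λ r → ⊔ᴹ-least (p r) (p′ r)) , (λ σ → ⊔ᴹ-least (q σ) (q′ σ))

  ≼ᴱ⇒⊑ᴱ : ∀ {E E′} → E ≼ᴱ E′ → E ⊑ᴱ E′
  ≼ᴱ⇒⊑ᴱ (p , q) = (λ r → ≼⇒⊑* (p r)) , (λ σ → ≼⇒⊑* (q σ))

  -- The join of a family of effects over a list, in the form used by checkM.
  module _ {X : Set} (c : X → Effect) where

    private
      join : List X → Effect
      join = foldr (λ x acc → c x ⊔ᴱ acc) ∅ᴱ

    foldr-upper : ∀ {x xs} → x ∈ˡ xs → c x ≼ᴱ join xs
    foldr-upper {x} {_ ∷ xs} (here refl) = ⊔ᴱ-upperˡ (c x) (join xs)
    foldr-upper {x} {y ∷ xs} (there x∈)  =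
      ≼ᴱ-trans (foldr-upper x∈) (⊔ᴱ-upperʳ (c y) (join xs))

    foldr-least : ∀ {E} xs → (∀ x → c x ≼ᴱ E) → join xs ≼ᴱ E
    foldr-least []       h = ∅ᴱ-least
    foldr-least (x ∷ xs) h = ⊔ᴱ-least (h x) (foldr-least xs h)

  -- The pointwise inclusion of field tables, at the fields that a class has.
  _≼ᶠ_ : FTable → FTable → Set
  F ≼ᶠ F′ = ∀ C r f (f∈ : f ∈ fields C) s → s ∈ᴿ F C r f f∈ → s ∈ᴿ F′ C r f f∈

  ≼ᶠ-refl : ∀ {F} → F ≼ᶠ F
  ≼ᶠ-refl _ _ _ _ _ = id

  ≼ᶠ-trans : ∀ {F F′ F″} → F ≼ᶠ F′ → F′ ≼ᶠ F″ → F ≼ᶠ F″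
  ≼ᶠ-trans p q C r f f∈ s = q C r f f∈ s ∘ p C r f f∈ s

  -- The componentwise order on tables.
  _≼ᵗ_ : Table → Table → Set
  (F , M) ≼ᵗ (F′ , M′) = F ≼ᶠ F′ × (∀ σ → M σ ≼ᴱ M′ σ)

  ≼ᵗ-refl : ∀ {t} → t ≼ᵗ t
  ≼ᵗ-refl = ≼ᶠ-refl , λ _ → ≼ᴱ-refl

  ≼ᵗ-trans : ∀ {t t′ t″} → t ≼ᵗ t′ → t′ ≼ᵗ t″ → t ≼ᵗ t″
  ≼ᵗ-trans (p , q) (p′ , q′) = ≼ᶠ-trans p p′ , λ σ → ≼ᴱ-trans (q σ) (q′ σ)

  ≼ᵗ-antisym : ∀ {t t′} → t ≼ᵗ t′ → t′ ≼ᵗ t → t ≗ᵗ t′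
  ≼ᵗ-antisym (p , q) (p′ , q′) =
      (λ C r f f∈ s → T-ext (p C r f f∈ s) (p′ C r f f∈ s))
    , (λ σ → (λ r → ≼-antisym (proj₁ (q σ) r) (proj₁ (q′ σ) r))
           , (λ τ → ≼-antisym (proj₂ (q σ) τ) (proj₂ (q′ σ) τ)))

  entry-defined : ∀ F {D r f s} (f∈ : f ∈ fields D) → entry F D r f s ≡ F D r f f∈ s
  entry-defined F {D} {f = f} f∈ with f ∈? fields D
  ... | yes _  = refl
  ... | no f∉ = contradiction f∈ f∉

  -- The closure operator checkClassTable

  Related-sym : ∀ {f C D} → Related f C D → Related f D C
  Related-sym (f∈C , f∈D , inj₁ C⪯D) = f∈D , f∈C , inj₂ C⪯D
  Related-sym (f∈C , f∈D , inj₂ D⪯C) = f∈D , f∈C , inj₁ D⪯C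

  ∈-allRegions : ∀ r → r ∈ˡ allRegions
  ∈-allRegions Null          = here refl
  ∈-allRegions Unknown       = there (here refl)
  ∈-allRegions (CreatedAt ℓ) = there (there (∈-map⁺ CreatedAt (∈-allFin ℓ)))

  -- The condition under which checkF puts s into the entry of C, r and f: s is Null, or s
  -- lies in an entry of a class tied to C by subclassing among classes with field f, at
  -- the region r itself or, for r = Unknown, at any region.
  data Derived (F : FTable) (C : Cls) (r : Region) (f : Fld) (s : Region) : Set where
    isNull : s ≡ Null → Derived F C r f s
    shared : ∀ {D r′} → Star (Related f) C D → r ≡ Unknown ⊎ r ≡ r′ →
             T (entry F D r′ f s) → Derived F C r f s

  private
    -- The Boolean subterms of checkF.
    matches : Region → Region → Bool
    matches r r′ = ⌊ r ≟ᴿ Unknown ⌋ ∨ ⌊ r ≟ᴿ r′ ⌋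

    matches⁺ : ∀ {r r′} → r ≡ Unknown ⊎ r ≡ r′ → T (matches r r′)
    matches⁺ {r} (inj₁ p) = from (T-∨ {⌊ r ≟ᴿ Unknown ⌋}) (inj₁ (fromWitness p))
    matches⁺ {r} (inj₂ p) = from (T-∨ {⌊ r ≟ᴿ Unknown ⌋}) (inj₂ (fromWitness p))

    matches⁻ : ∀ {r r′} → T (matches r r′) → r ≡ Unknown ⊎ r ≡ r′
    matches⁻ {r} {r′} h with to (T-∨ {⌊ r ≟ᴿ Unknown ⌋}) h
    ... | inj₁ p = inj₁ (toWitness {a? = r ≟ᴿ Unknown} p)
    ... | inj₂ p = inj₂ (toWitness {a? = r ≟ᴿ r′} p)

    fromRegion : FTable → Region → Fld → Region → Cls → Region → Bool
    fromRegion F r f s D r′ = matches r r′ ∧ entry F D r′ f s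

    fromClass : FTable → Cls → Region → Fld → Region → Cls → Bool
    fromClass F C r f s D = ⌊ sameField? f C D ⌋ ∧ any (fromRegion F r f s D) allRegions

  ∈-checkF⁺ : ∀ F C r f s (f∈ : f ∈ fields C) → Derived F C r f s → s ∈ᴿ checkF F C r f f∈
  ∈-checkF⁺ F C r f s f∈ (isNull s≡Null) =
    from (T-∨ {⌊ s ≟ᴿ Null ⌋}) (inj₁ (fromWitness s≡Null))
  ∈-checkF⁺ F C r f s f∈ (shared {D} {r′} C~D r≤ s∈) = from (T-∨ {⌊ s ≟ᴿ Null ⌋}) (inj₂
    (any⁺ (fromClass F C r f s) (lose (∈-allFin D)
      (from (T-∧ {⌊ sameField? f C D ⌋}) (fromWitness C~D ,
        any⁺ (fromRegion F r f s D) (lose (∈-allRegions r′)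
          (from (T-∧ {matches r r′}) (matches⁺ r≤ , s∈))))))))

  ∈-checkF⁻ : ∀ F C r f s (f∈ : f ∈ fields C) → s ∈ᴿ checkF F C r f f∈ → Derived F C r f s
  ∈-checkF⁻ F C r f s f∈ s∈ with to (T-∨ {⌊ s ≟ᴿ Null ⌋}) s∈
  ... | inj₁ p = isNull (toWitness {a? = s ≟ᴿ Null} p)
  ... | inj₂ p with find (any⁻ (fromClass F C r f s) (allFin #Cls) p)
  ... | D , _ , q with to (T-∧ {⌊ sameField? f C D ⌋}) q
  ... | C~D , q′ with find (any⁻ (fromRegion F r f s D) allRegions q′)
  ... | r′ , _ , q″ with to (T-∧ {matches r r′}) q″
  ... | r≤ , s∈′ = shared (toWitness {a? = sameField? f C D} C~D) (matches⁻ {r} {r′} r≤) s∈′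

  checkF-inflationary : ∀ F → F ≼ᶠ checkF F
  checkF-inflationary F C r f f∈ s s∈ =
    ∈-checkF⁺ F C r f s f∈ (shared ε (inj₂ refl) (subst T (sym (entry-defined F f∈)) s∈))

  Derived-related : ∀ {F C D r f s} → Related f D C → Derived F C r f s → Derived F D r f s
  Derived-related D~C (isNull e)         = isNull e
  Derived-related D~C (shared C~ r≤ s∈) = shared (D~C ◅ C~) r≤ s∈

  Derived-Unknown : ∀ {F C r f s} → Derived F C r f s → Derived F C Unknown f s
  Derived-Unknown (isNull e)        = isNull e
  Derived-Unknown (shared C~ _ s∈) = shared C~ (inj₁ refl) s∈

  -- The witness is the family of contributions local to the definition of checkM; pairing
  -- it with the equation gives access to it.
  checkM-join : ∀ M σ → Σ[ c ∈ (Cls → Effect) ]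
    checkM M σ ≡ foldr (λ C acc → c C ⊔ᴱ acc) ∅ᴱ (allFin #Cls)
  checkM-join M σ = _ , refl

  checkM-upper : ∀ M {C D r m s} (m∈C : m ∈ methods C) (m∈D : m ∈ methods D) → C ⪯ D →
                 M (sig C r m s m∈C) ≼ᴱ checkM M (sig D r m s m∈D)
  checkM-upper M {C} {D} {r} {m} {s} m∈C m∈D C⪯D =
    ≼ᴱ-trans step (foldr-upper (proj₁ (checkM-join M (sig D r m s m∈D))) (∈-allFin C))
    where
    step : M (sig C r m s m∈C) ≼ᴱ proj₁ (checkM-join M (sig D r m s m∈D)) C
    step with C ⪯? D | m ∈? methods C
    ... | yes _  | yes _   = ≼ᴱ-refl
    ... | yes _  | no m∉C  = contradiction m∈C m∉C
    ... | no C⋠D | _       = contradiction C⪯D C⋠D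

  checkM-least : ∀ M {D r m s} (m∈D : m ∈ methods D) {E} →
                 (∀ C (m∈C : m ∈ methods C) → C ⪯ D → M (sig C r m s m∈C) ≼ᴱ E) →
                 checkM M (sig D r m s m∈D) ≼ᴱ E
  checkM-least M {D} {r} {m} {s} m∈D {E} h =
    foldr-least (proj₁ (checkM-join M (sig D r m s m∈D))) (allFin #Cls) step
    where
    step : ∀ C → proj₁ (checkM-join M (sig D r m s m∈D)) C ≼ᴱ E
    step C with C ⪯? D | m ∈? methods C
    ... | yes C⪯D | yes m∈C = h C m∈C C⪯D
    ... | yes _   | no _    = ∅ᴱ-least
    ... | no _    | yes _   = ∅ᴱ-least
    ... | no _    | no _    = ∅ᴱ-least

  checkM-inflationary : ∀ M σ → M σ ≼ᴱ checkM M σ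
  checkM-inflationary M (sig C r m s m∈) = checkM-upper M m∈′ m∈′ ε
    where
    m∈′ : m ∈ methods C
    m∈′ = recompute (m ∈? methods C) m∈

  checkClassTable-inflationary : ∀ t → t ≼ᵗ checkClassTable t
  checkClassTable-inflationary (F , M) = checkF-inflationary F , checkM-inflationary M

  checkClassTable-wellFormed : ∀ t → WellFormedTable (checkClassTable t)
  checkClassTable-wellFormed (F , M) = record
    { Null∈     = λ C r f f∈ → ∈-checkF⁺ F C r f Null f∈ (isNull refl)
    ; ⊆Unknown  = λ C r f f∈ s s∈ →
        ∈-checkF⁺ F C Unknown f s f∈ (Derived-Unknown (∈-checkF⁻ F C r f s f∈ s∈))
    ; invariant = λ {C} {D} r f f∈C f∈D C⪯D s →
        let C~D = f∈C , f∈D , inj₁ C⪯D in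
        T-ext (λ s∈ → ∈-checkF⁺ F D r f s f∈D
                        (Derived-related (Related-sym C~D) (∈-checkF⁻ F C r f s f∈C s∈)))
              (λ s∈ → ∈-checkF⁺ F C r f s f∈C
                        (Derived-related C~D (∈-checkF⁻ F D r f s f∈D s∈)))
    ; variant   = λ _ _ _ m∈C m∈D C⪯D →
        ≼ᴱ⇒⊑ᴱ (checkM-least M m∈C λ _ m∈ ⪯C → checkM-upper M m∈ m∈D (⪯C ◅◅ C⪯D))
    }

  initial-wellFormed : WellFormedTable initial
  initial-wellFormed = record
    { Null∈     = λ _ _ _ _ → tt
    ; ⊆Unknown  = λ _ _ _ _ _ s∈ → s∈
    ; invariant = λ _ _ _ _ _ → λ _ → refl
    ; variant   = λ _ _ _ _ _ _ → ≼ᴱ⇒⊑ᴱ (≼ᴱ-refl {∅ᴱ})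
    }

  -- Typing derivations and environments

  infix 4 _∣_⊢_∶_
  -- Büchi typing with respect to a given table, with the two parts of the effect paired.
  _∣_⊢_∶_ : Table → Env Region → Expr → Effect → Set
  u ∣ Γ ⊢ e ∶ (𝒯 , 𝒮) = Typing._⊢_∶_calls_ u Γ e 𝒯 𝒮

  subsume : ∀ {u Γ e E E′} → u ∣ Γ ⊢ e ∶ E → E ≼ᴱ E′ → u ∣ Γ ⊢ e ∶ E′
  subsume d E≼E′ = Typing.sub d (proj₁ (≼ᴱ⇒⊑ᴱ E≼E′)) (proj₂ (≼ᴱ⇒⊑ᴱ E≼E′))

  -- Every variable bound in the first environment is bound in the second.
  Covers : {X Y : Set} → Env X → Env Y → Set
  Covers Γ₀ Γ = ∀ y → Is-just (Γ₀ y) → Is-just (Γ y)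

  ↦-covers : ∀ {X Y : Set} {Γ₀ : Env X} {Γ : Env Y} {c r} x →
             Covers Γ₀ Γ → Covers (Γ₀ [ x ↦ c ]) (Γ [ x ↦ r ])
  ↦-covers x cov y with x ≟ⱽ y
  ... | yes _ = λ _ → just tt
  ... | no _  = cov y

  ↦*-covers : ∀ {X Y : Set} {n} {Γ₀ : Env X} {Γ : Env Y} (xs : Vec Var n) {cs rs} →
              Covers Γ₀ Γ → Covers (Γ₀ [ xs ↦* cs ]) (Γ [ xs ↦* rs ])
  ↦*-covers []       {[]}    {[]}    cov = cov
  ↦*-covers (x ∷ xs) {_ ∷ _} {_ ∷ _} cov = ↦*-covers xs (↦-covers x cov)

  bodyEnv-covers : ∀ {X Y : Set} {n} {c : X} {r : Y} (xs : Vec Var n) {cs rs} →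
                   Covers (bodyEnv c xs cs) (bodyEnv r xs rs)
  bodyEnv-covers xs = ↦*-covers xs (↦-covers this λ _ ())

  guard-yes : {X : Set} (d : Dec X) (x : X) → ∃[ x′ ] guard d ≡ just x′
  guard-yes (yes x) _ = x , refl
  guard-yes (no ¬x) x = contradiction x ¬x

  -- A lower bound of a table stays one when the field part grows.
  growF : ∀ {u F F′} {M : MTable} → F ≼ᶠ F′ → u ≼ᵗ (F , M) → u ≼ᵗ (F′ , M)
  growF F≼F′ (p , q) = ≼ᶠ-trans p F≼F′ , q

  addF-inflationary : ∀ C r f s F → F ≼ᶠ addF C r f s F
  addF-inflationary _ _ _ _ F C r f f∈ s s∈ = from (T-∨ {F C r f f∈ s}) (inj₁ s∈)

  addF-adds : ∀ {C r f s F} (f∈ : f ∈ fields C) → s ∈ᴿ addF C r f s F C r f f∈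
  addF-adds {C} {r} {f} {s} {F} f∈ = from (T-∨ {F C r f f∈ s}) (inj₂
    (from (T-∧ {⌊ C Fin.≟ C ⌋}) (fromWitness refl ,
     from (T-∧ {⌊ r ≟ᴿ r ⌋}) (fromWitness refl ,
     from (T-∧ {⌊ f Fin.≟ f ⌋}) (fromWitness refl , fromWitness refl)))))

  ⨆&-mono : ∀ {X Y : 𝒫Region} → (∀ s → s ∈ᴿ X → s ∈ᴿ Y) → ∀ s → ⨆& X s ≼ ⨆& Y s
  ⨆&-mono {X} {Y} X⊆Y s with X s | Y s | X⊆Y s
  ... | false | _     | _ = nothing≼ _
  ... | true  | true  | _ = ≼-refl
  ... | true  | false | h = ⊥-elim (h tt)

  ⨆let-least : ∀ {𝒯} ℰ {E} → (∀ r U → 𝒯 r ≡ just U → U ⊙ᴱ ℰ r ≼ᴱ E) →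
               ∀ qs → ⨆let qs 𝒯 ℰ ≼ᴱ E
  ⨆let-least ℰ h [] = ∅ᴱ-least
  ⨆let-least {𝒯} ℰ h (r ∷ qs) with 𝒯 r in eq
  ... | nothing = ⨆let-least ℰ h qs
  ... | just U  = ⊔ᴱ-least (h r U eq) (⨆let-least ℰ h qs)

  module _ (T₀ : Standard.ClassTable₀ P) where
    open Standard P hiding (WellTyped₀)

    infix 4 _⊢₀_∶′_
    _⊢₀_∶′_ : Env Cls → Expr → Cls → Set
    _⊢₀_∶′_ = _⊢₀_∶_ T₀

    var-bound : ∀ {Γ₀ x C} → Γ₀ ⊢₀ var x ∶′ C → Is-just (Γ₀ x)
    var-bound (sub₀ d _) = var-bound d
    var-bound (var₀ eq)  = ≡just⇒Is-just eq

    args-bound : ∀ {Γ₀} {Γ : Env Region} {n} {ys : Vec Var n} {Ds : Vec Cls n} → Covers Γ₀ Γ →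
                 Pointwise (λ y D → Γ₀ ⊢₀ var y ∶′ D) ys Ds → ∃[ s ] lookup* Γ ys ≡ just s
    args-bound cov [] = [] , refl
    args-bound {ys = y ∷ _} cov (d ∷ ds) with Is-just⇒≡just (cov y (var-bound d)) | args-bound cov ds
    ... | r , Γy | s , Γys rewrite Γy | Γys = r ∷ s , refl

    module _ (rs : List Region) (∈rs : ∀ r → r ∈ˡ rs) where
      open Inference rs

      -- Type inference for expressions

      -- What is known of typeff M Γ e F: it is defined, it increases F, and the effect that it
      -- returns is derivable with respect to every table u below (F , M) whose field part lies
      -- above the field table F′ that typeff leaves behind.
      record Inferred (M : MTable) (Γ : Env Region) (e : Expr) (F : FTable) : Set where
        constructor inferred
        field
          {F′}    : FTable
          {E}     : Effect
          defined : typeff M Γ e F ≡ just (F′ , E)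
          grows   : F ≼ᶠ F′
          typed   : ∀ u → u ≼ᵗ (F , M) → F′ ≼ᶠ proj₁ u → u ∣ Γ ⊢ e ∶ E

      -- The analogue for the branches of a let: branch r is the effect found for the body with
      -- x bound to r, and its multiple by the entry of 𝒯 at r lies below the returned join E.
      -- This makes E an upper bound of the join in the let rule, whichever order the regions
      -- are visited in.
      record BranchesInferred (M : MTable) (Γ : Env Region) (x : Var) (e : Expr)
                              (𝒯 : M*⟨ Region ⟩) (qs : List Region) (F : FTable) : Set where
        field
          {F′}    : FTable
          {E}     : Effect
          defined : letBranches (λ r → typeff M (Γ [ x ↦ r ]) e) 𝒯 qs F ≡ just (F′ , E)
          grows   : F ≼ᶠ F′
          branch  : Region → Effect
          upper   : ∀ {r U} → r ∈ˡ qs → 𝒯 r ≡ just U → U ⊙ᴱ branch r ≼ᴱ E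
          typed   : ∀ u → u ≼ᵗ (F , M) → F′ ≼ᶠ proj₁ u →
                    ∀ {r U} → r ∈ˡ qs → 𝒯 r ≡ just U → u ∣ (Γ [ x ↦ r ]) ⊢ e ∶ branch r

      inferBranches : ∀ {M Γ x e} → (∀ r F → Inferred M (Γ [ x ↦ r ]) e F) →
                      ∀ 𝒯 qs F → BranchesInferred M Γ x e 𝒯 qs F
      inferBranches body 𝒯 [] F = record
        { defined = refl ; grows = ≼ᶠ-refl ; branch = λ _ → ∅ᴱ
        ; upper = λ () ; typed = λ _ _ _ () }
      inferBranches {M} {Γ} {x} {e} body 𝒯 (q ∷ qs) F with 𝒯 q in 𝒯q
      ... | nothing = record
        { defined = skip
        ; grows   = R.grows
        ; branch  = R.branch
        ; upper   = λ { (here refl) 𝒯q′ → nothing≢ 𝒯q′ ; (there r∈) → R.upper r∈ }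
        ; typed   = λ { u lo hi (here refl) 𝒯q′ → nothing≢ 𝒯q′
                      ; u lo hi (there r∈) → R.typed u lo hi r∈ }
        }
        where
        module R = BranchesInferred (inferBranches body 𝒯 qs F)
        nothing≢ : ∀ {U} {Y : Set} → 𝒯 q ≡ just U → Y
        nothing≢ 𝒯q′ with () ← trans (sym 𝒯q) 𝒯q′
        skip : letBranches (λ r → typeff M (Γ [ x ↦ r ]) e) 𝒯 (q ∷ qs) F ≡ just (R.F′ , R.E)
        skip rewrite 𝒯q = R.defined
      ... | just V = record
        { defined = step
        ; grows   = ≼ᶠ-trans B.grows R.grows
        ; branch  = branch
        ; upper   = upper
        ; typed   = typed
        }
        where
        module B = Inferred (body q F)
        module R = BranchesInferred (inferBranches body 𝒯 qs B.F′)
        step : letBranches (λ r → typeff M (Γ [ x ↦ r ]) e) 𝒯 (q ∷ qs) F ≡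
               just (R.F′ , (V ⊙ᴱ B.E) ⊔ᴱ R.E)
        step rewrite 𝒯q | B.defined | R.defined = refl

        branch : Region → Effect
        branch r with q ≟ᴿ r
        ... | yes _ = B.E
        ... | no _  = R.branch r

        upper : ∀ {r U} → r ∈ˡ (q ∷ qs) → 𝒯 r ≡ just U → U ⊙ᴱ branch r ≼ᴱ (V ⊙ᴱ B.E) ⊔ᴱ R.E
        upper {r} r∈ 𝒯r with q ≟ᴿ r | r∈
        ... | yes refl | _ with refl ← trans (sym 𝒯q) 𝒯r = ⊔ᴱ-upperˡ (V ⊙ᴱ B.E) R.E
        ... | no q≢r | here r≡q  = contradiction (sym r≡q) q≢r
        ... | no _   | there r∈′ = ≼ᴱ-trans (R.upper r∈′ 𝒯r) (⊔ᴱ-upperʳ (V ⊙ᴱ B.E) R.E)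

        typed : ∀ u → u ≼ᵗ (F , M) → R.F′ ≼ᶠ proj₁ u →
                ∀ {r U} → r ∈ˡ (q ∷ qs) → 𝒯 r ≡ just U → u ∣ (Γ [ x ↦ r ]) ⊢ e ∶ branch r
        typed u lo hi {r} r∈ 𝒯r with q ≟ᴿ r | r∈
        ... | yes refl | _       = B.typed u lo (≼ᶠ-trans R.grows hi)
        ... | no q≢r | here r≡q  = contradiction (sym r≡q) q≢r
        ... | no _   | there r∈′ = R.typed u (growF B.grows lo) hi r∈′ 𝒯r

      -- Definedness, growth and soundness of typeff, by induction on the standard derivation.
      -- Of Γ it is only needed that it binds the variables that Γ₀ binds; the classes in Γ₀
      -- and the regions in Γ are unrelated.
      infer : ∀ {Γ₀ Γ e D} → Γ₀ ⊢₀ e ∶′ D → Covers Γ₀ Γ → ∀ M F → Inferred M Γ e F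
      infer (sub₀ d _) cov M F = infer d cov M F
      infer {Γ = Γ} (var₀ {x} Γ₀x) cov M F with Is-just⇒≡just (cov x (≡just⇒Is-just Γ₀x))
      ... | r , Γx = inferred eq ≼ᶠ-refl (λ _ _ _ → Typing.var Γx)
        where
        eq : typeff M Γ (var x) F ≡ just (F , r & unit* , ∅ᵖ)
        eq rewrite Γx = refl
      infer null₀ cov M F = inferred refl ≼ᶠ-refl (λ _ _ _ → Typing.null)
      infer emit₀ cov M F = inferred refl ≼ᶠ-refl (λ _ _ _ → Typing.prim)
      infer (new₀ C≢) cov M F = inferred refl ≼ᶠ-refl (λ _ _ _ → Typing.new C≢)
      infer (cast₀ C≢ d) cov M F with infer d cov M F
      ... | inferred eq F≼F′ ty = inferred eq F≼F′ (λ u lo hi → Typing.cast C≢ (ty u lo hi))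
      infer {Γ = Γ} (let₀ {x} {e₁} {e₂} d₁ d₂) cov M F =
        inferred eq (≼ᶠ-trans I.grows B.grows) typed
        where
        module I = Inferred (infer d₁ cov M F)
        module B = BranchesInferred
          (inferBranches {x = x} (λ r → infer d₂ (↦-covers {r = r} x cov) M) (proj₁ I.E) rs I.F′)
        eq : typeff M Γ (let′ x e₁ e₂) F ≡ just (B.F′ , proj₁ B.E , proj₂ I.E ⊔ᵖ proj₂ B.E)
        eq rewrite I.defined | B.defined = refl
        typed : ∀ u → u ≼ᵗ (F , M) → B.F′ ≼ᶠ proj₁ u →
                u ∣ Γ ⊢ let′ x e₁ e₂ ∶ (proj₁ B.E , proj₂ I.E ⊔ᵖ proj₂ B.E)
        -- The let rule joins over allRegions and the algorithm over rs; the former join is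
        -- the least upper bound of the branches and so lies below the latter.
        typed u lo hi = subsume
          (Typing.let′ B.branch (I.typed u lo (≼ᶠ-trans B.grows hi))
            (λ r U → B.typed u (growF I.grows lo) hi (∈rs r)))
          (proj₁ bound , λ σ → ⊔ᴹ-least (⊔ᴹ-upperˡ _ _)
                                 (≼-trans (proj₂ bound σ) (⊔ᴹ-upperʳ (proj₂ I.E σ) _)))
          where
          bound : ⨆let allRegions (proj₁ I.E) B.branch ≼ᴱ B.E
          bound = ⨆let-least B.branch (λ r U → B.upper (∈rs r)) allRegions
      infer {Γ = Γ} (if₀ {x} {y} {e₁} {e₂} x∈ y∈ d₁ d₂) cov M F
        with Is-just⇒≡just (cov x x∈) | Is-just⇒≡just (cov y y∈)
      ... | r , Γx | s , Γy with disjoint? r s in dis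
      ... | yes r#s = inferred eq I.grows (λ u lo hi → Typing.else Γx Γy r#s (I.typed u lo hi))
        where
        module I = Inferred (infer d₂ cov M F)
        eq : typeff M Γ (ifEq x y e₁ e₂) F ≡ just (I.F′ , I.E)
        eq rewrite Γx | Γy | dis = I.defined
      ... | no _ = inferred eq (≼ᶠ-trans I.grows J.grows) λ u lo hi →
          Typing.if (cov x x∈) (cov y y∈)
            (I.typed u lo (≼ᶠ-trans J.grows hi)) (J.typed u (growF I.grows lo) hi)
        where
        module I = Inferred (infer d₁ cov M F)
        module J = Inferred (infer d₂ cov M I.F′)
        eq : typeff M Γ (ifEq x y e₁ e₂) F ≡ just (J.F′ , I.E ⊔ᴱ J.E)
        eq rewrite Γx | Γy | dis | I.defined | J.defined = refl
      infer {Γ = Γ} (get₀ {x} {C} {f} d f∈) cov M F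
        with Is-just⇒≡just (cov x (var-bound d)) | guard-yes (f ∈? fields C) f∈
      ... | r , Γx | f∈′ , guarded = inferred eq ≼ᶠ-refl λ u lo hi →
          -- The entry read by typeff lies above that of u, which the rule returns.
          subsume (Typing.get Γx f∈)
            (⨆&-mono (proj₁ lo C r f f∈) , λ _ → nothing≼ _)
        where
        eq : typeff M Γ (get x C f) F ≡ just (F , ⨆& (F C r f f∈) , ∅ᵖ)
        eq rewrite Γx | guarded = refl
      infer {Γ = Γ} (set₀ {x} {y} {C} {f} d f∈ d′) cov M F
        with Is-just⇒≡just (cov x (var-bound d)) | Is-just⇒≡just (cov y (var-bound d′))
           | guard-yes (f ∈? fields C) f∈
      ... | r , Γx | s , Γy | f∈′ , guarded = inferred eq (addF-inflationary C r f s F) λ u lo hi →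
          -- typeff adds the region to the entry, and the field part of u lies above the result.
          Typing.set Γx Γy f∈ (hi C r f f∈ s (addF-adds {F = F} f∈))
        where
        eq : typeff M Γ (set x C f y) F ≡ just (addF C r f s F , s & unit* , ∅ᵖ)
        eq rewrite Γx | Γy | guarded = refl
      infer {Γ = Γ} (call₀ {x} {C} {m} {ys} d m∈ ds) cov M F
        with Is-just⇒≡just (cov x (var-bound d)) | args-bound cov ds
           | guard-yes (m ∈? methods C) m∈
      ... | r , Γx | s , Γys | m∈′ , guarded = inferred eq ≼ᶠ-refl λ u lo hi →
          subsume (Typing.call Γx Γys m∈) (proj₁ (proj₂ lo (sig C r m s m∈)) , λ _ → ≼-refl)
        where
        eq : typeff M Γ (call x C m ys) F ≡
             just (F , proj₁ (M (sig C r m s m∈)) , callTo (sig C r m s m∈))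
        eq rewrite Γx | Γys | guarded = refl

      -- Visits and rounds

      -- The well-typedness condition that the entry of σ in u imposes.
      TypedAt : Table → Sig → Set
      TypedAt u σ@(sig C r m s _) = ∀ {xs e} → C ∈Cls r → mtable C m ≡ just (xs , e) →
                                    u ∣ bodyEnv r xs s ⊢ e ∶ proj₂ u σ

      -- An iteration step from t is defined, increases t and preserves well-formedness, and it
      -- establishes Q for all tables squeezed between its result and t.  As the step is
      -- increasing, such tables exist only if it leaves t unchanged.
      record Step (outcome : Maybe Table) (t : Table) (Q : Table → Set) : Set where
        field
          {result}   : Table
          defined    : outcome ≡ just result
          grows      : t ≼ᵗ result
          wellFormed : WellFormedTable t → WellFormedTable result
          typed      : ∀ u → u ≼ᵗ t → result ≼ᵗ u → Q u

      joinM-inflationary : ∀ σ E M τ → M τ ≼ᴱ joinM σ E M τ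
      joinM-inflationary σ E M τ with σ ≟ˢ τ
      ... | yes _ = ⊔ᴱ-upperˡ (M τ) E
      ... | no _  = ≼ᴱ-refl

      joinM-adds : ∀ σ E M → E ≼ᴱ joinM σ E M σ
      joinM-adds σ E M with σ ≟ˢ σ
      ... | yes _  = ⊔ᴱ-upperʳ (M σ) E
      ... | no σ≢σ = contradiction refl σ≢σ

      module _ (P-typed₀ : Standard.WellTyped₀ P T₀) where

        visit-step : ∀ σ t → Step (visit σ t) t (λ u → TypedAt u σ)
        visit-step σ@(sig C r m s m∈) t@(F , M) with C ∈Cls? r | mtable C m in body
        ... | no C∉r | _       = record
          { defined = refl ; grows = ≼ᵗ-refl ; wellFormed = id
          ; typed = λ _ _ _ C∈r _ → contradiction C∈r C∉r }
        ... | yes _  | nothing = record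
          { defined = refl ; grows = ≼ᵗ-refl ; wellFormed = id ; typed = λ _ _ _ _ () }
        ... | yes _  | just (xs , e) = record
          { defined    = eq
          ; grows      = ≼ᵗ-trans (I.grows , joinM-inflationary σ I.E M) checked
          ; wellFormed = λ _ → checkClassTable-wellFormed t′
          ; typed      = λ { u lo hi _ refl →
              let t′≼u = ≼ᵗ-trans checked hi in
              subsume (I.typed u lo (proj₁ t′≼u)) (≼ᴱ-trans (joinM-adds σ I.E M) (proj₂ t′≼u σ)) }
          }
          where
          module I = Inferred (infer (P-typed₀ C m (recompute (m ∈? methods C) m∈) body)
                                     (bodyEnv-covers {r = r} xs {rs = s}) M F)
          t′ : Table
          t′ = I.F′ , joinM σ I.E M
          checked : t′ ≼ᵗ checkClassTable t′
          checked = checkClassTable-inflationary t′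
          eq : (typeff M (bodyEnv r xs s) e F >>= λ (F′ , E) →
                  just (checkClassTable (F′ , joinM σ E M))) ≡ just (checkClassTable t′)
          eq rewrite I.defined = refl

        round-step : ∀ σs t → Step (round σs t) t (λ u → ∀ {σ} → σ ∈ˡ σs → TypedAt u σ)
        round-step []       t = record
          { defined = refl ; grows = ≼ᵗ-refl ; wellFormed = id ; typed = λ _ _ _ () }
        round-step (σ ∷ σs) t = record
          { defined    = eq
          ; grows      = ≼ᵗ-trans V.grows R.grows
          ; wellFormed = R.wellFormed ∘ V.wellFormed
          ; typed      = λ where
              u lo hi (here refl) → V.typed u lo (≼ᵗ-trans R.grows hi)
              u lo hi (there σ∈)  → R.typed u (≼ᵗ-trans lo V.grows) hi σ∈
          }
          where
          module V = Step (visit-step σ t)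
          module R = Step (round-step σs V.result)
          eq : round (σ ∷ σs) t ≡ just R.result
          eq rewrite V.defined = R.defined

  -- Termination

  module Termination (sigs : List Sig) (∈sigs : ∀ σ → σ ∈ˡ sigs) where

    M*-listing : Listing M*
    M*-listing with finite*
    ... | n , M*↔Fin = map back (allFin n) , λ U →
      subst (_∈ˡ map back (allFin n)) (strictlyInverseʳ U) (∈-map⁺ back (∈-allFin _))
      where open Inverse M*↔Fin using (strictlyInverseʳ) renaming (from to back)

    _⊑*?_ : ∀ U V → Dec (U ⊑* V)
    U ⊑*? V = map′ (λ eq → subst (U ⊑*_) eq (x≤x∨y U V))
                   (λ U⊑V → antisym (∨-least U⊑V ⊑*-refl) (y≤x∨y U V))
                   (Fin.inj⇒≟ (↔⇒↣ (proj₂ finite*)) (U ⊔* V) V)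

    _≼?_ : ∀ x y → Dec (x ≼ y)
    _≼?_ = ≤₋-dec _⊑*_ _⊑*?_

    -- An elementary fact about a table: a region s lies in the entry of C, r and f, or an
    -- element U of M* lies below the entry of a result effect or of a call effect.  An entry
    -- U is recovered as the greatest element below it, and an undefined entry as one with
    -- none, so that the facts determine a table.
    Fact : Set
    Fact = (Cls × Region × Fld × Region) ⊎ (Sig × Region × M*) ⊎ (Sig × Sig × M*)

    fact-listing : Listing Fact
    fact-listing =
      (Cls-l ×-listing (Reg-l ×-listing (Fld-l ×-listing Reg-l))) ⊎-listing
      ((Sig-l ×-listing (Reg-l ×-listing M*-listing)) ⊎-listing
       (Sig-l ×-listing (Sig-l ×-listing M*-listing)))
      where
      Cls-l : Listing Cls
      Cls-l = allFin #Cls , ∈-allFin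
      Fld-l : Listing Fld
      Fld-l = allFin #Fld , ∈-allFin
      Reg-l : Listing Region
      Reg-l = allRegions , ∈-allRegions
      Sig-l : Listing Sig
      Sig-l = sigs , ∈sigs

    Holds : Table → Fact → Set
    Holds (F , M) (inj₁ (C , r , f , s))        = T (entry F C r f s)
    Holds (F , M) (inj₂ (inj₁ (σ , r , U)))     = just U ≼ proj₁ (M σ) r
    Holds (F , M) (inj₂ (inj₂ (σ , τ , U)))     = just U ≼ proj₂ (M σ) τ

    holds? : ∀ t p → Dec (Holds t p)
    holds? (F , M) (inj₁ (C , r , f , s))    = T? (entry F C r f s)
    holds? (F , M) (inj₂ (inj₁ (σ , r , U))) = just U ≼? proj₁ (M σ) r
    holds? (F , M) (inj₂ (inj₂ (σ , τ , U))) = just U ≼? proj₂ (M σ) τ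

    Holds-mono : ∀ {t t′} → t ≼ᵗ t′ → ∀ p → Holds t p → Holds t′ p
    Holds-mono {F , _} {F′ , _} (F≼F′ , _) (inj₁ (C , r , f , s)) with f ∈? fields C
    ... | yes f∈ = F≼F′ C r f f∈ s
    ... | no _   = id
    Holds-mono (_ , M≼M′) (inj₂ (inj₁ (σ , r , _))) h = ≼-trans h (proj₁ (M≼M′ σ) r)
    Holds-mono (_ , M≼M′) (inj₂ (inj₂ (σ , τ , _))) h = ≼-trans h (proj₂ (M≼M′ σ) τ)

    ≼-from-below : ∀ {x y} → (∀ U → just U ≼ x → just U ≼ y) → x ≼ y
    ≼-from-below {nothing} h = nothing≼ _
    ≼-from-below {just U}  h = h U ≼-refl

    Holds-reflects : ∀ {t t′} → (∀ p → Holds t p → Holds t′ p) → t ≼ᵗ t′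
    Holds-reflects {F , M} {F′ , M′} h = fieldsBelow , λ σ →
        (λ r → ≼-from-below (λ U → h (inj₂ (inj₁ (σ , r , U)))))
      , (λ τ → ≼-from-below (λ U → h (inj₂ (inj₂ (σ , τ , U)))))
      where
      fieldsBelow : F ≼ᶠ F′
      fieldsBelow C r f f∈ s s∈ = subst T (entry-defined F′ f∈)
        (h (inj₁ (C , r , f , s)) (subst T (sym (entry-defined F f∈)) s∈))

    -- Table equality gives both inequalities; this is the one that does not follow from growth.
    ≗ᵗ⇒≽ᵗ : ∀ {t t′} → t ≗ᵗ t′ → t′ ≼ᵗ t
    ≗ᵗ⇒≽ᵗ (F≗ , M≗) =
        (λ C r f f∈ s → subst T (sym (F≗ C r f f∈ s)))
      , λ σ → (λ r → ≼-reflexive (sym (proj₁ (M≗ σ) r))) , (λ τ → ≼-reflexive (sym (proj₂ (M≗ σ) τ)))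

    -- The number of facts that do not hold.
    gap : Table → ℕ
    gap t = length (filter (λ p → ¬? (holds? t p)) (proj₁ fact-listing))

    unchanged-or-closer : ∀ {t t′} → t ≼ᵗ t′ → t ≗ᵗ t′ ⊎ (¬ (t ≗ᵗ t′) × gap t′ < gap t)
    unchanged-or-closer {t} {t′} t≼t′ with anyList? (λ p → holds? t′ p ×-dec ¬? (holds? t p)) (proj₁ fact-listing)
    ... | no none = inj₁ (≼ᵗ-antisym t≼t′ (Holds-reflects λ p h →
          decidable-stable (holds? t p) λ ¬h → none (lose (proj₂ fact-listing p) (h , ¬h))))
    ... | yes some with find some
    ... | p , p∈ , h , ¬h = inj₂ ((λ t≗t′ → ¬h (Holds-mono (≗ᵗ⇒≽ᵗ t≗t′) p h))
        , length-filter-strict _ _ (λ {q} ¬h′ h′ → ¬h′ (Holds-mono t≼t′ q h′))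
                               p∈ ¬h (contradiction h))

  -- The loop

  module _ (T₀ : Standard.ClassTable₀ P) (P-typed₀ : Standard.WellTyped₀ P T₀)
           (sigs : Enumeration Sig) (regs : Enumeration Region) where
    open Enumeration
    open Loop sigs regs
    open Termination (list sigs) (complete sigs)

    -- Well-founded recursion on the number of false facts.  When a round leaves the table
    -- unchanged, its result lies below the table that the round started from, so it is
    -- squeezed between the two ends of the round and all visited bodies are typed by it.
    loop : ∀ t → WellFormedTable t → Acc _<_ (gap t) →
           ∃[ t′ ] (Returns t t′ × WellFormedTable t′ × WellTyped t′)
    loop t wf (acc smaller) with round-step T₀ (list regs) (complete regs) P-typed₀ (list sigs) t
    ... | step with unchanged-or-closer (Step.grows step)
    ... | inj₁ t≗t′ = _ , stop (Step.defined step) t≗t′ , Step.wellFormed step wf ,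
          λ C r m s m∈ → Step.typed step _ (≗ᵗ⇒≽ᵗ t≗t′) ≼ᵗ-refl (complete sigs (sig C r m s m∈))
    ... | inj₂ (t≢t′ , gap<) with loop _ (Step.wellFormed step wf) (smaller gap<)
    ... | t″ , returns , good = t″ , again (Step.defined step) t≢t′ returns , good

theorem5p11 : (k : ℕ) (𝔹 : BüchiAbstraction (Fin k)) (𝔄 : Lang≤ω (Fin k)) → FaithfulTo 𝔹 𝔄 →
    (N : Names) (P : Program (Fin k) N) → WellFormedProgram P →
    (T₀ : Standard.ClassTable₀ P) → Standard.WellTyped₀ P T₀ →
    (sigs : Enumeration (Büchi.Sig 𝔹 P)) →
    (regs : Enumeration (Syntax.Region (Fin k) N)) →
    ∃[ t ] (Büchi.𝒜-returns 𝔹 P sigs regs t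
    × Büchi.WellFormedTable 𝔹 P t
    × Büchi.WellTyped 𝔹 P t)
theorem5p11 k 𝔹 𝔄 _ N P _ T₀ P-typed₀ sigs regs =
  loop T₀ P-typed₀ sigs regs _ initial-wellFormed (<-wellFounded _)
  where open Correctness 𝔹 P
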